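{- Let $G$ be a regular graph of degree $r\geqslant 2$. Then $\chi'_a(G)\leqslant (5r+37)/3$.
   Context: All graphs are finite, without self-loops or multiple edges, and without isolated vertices. A graph is regular of degree $r$ if every vertex has degree $r$. A graph $G$ is normal if it contains no isolated edges (an isolated edge is an edge both of whose end vertices have degree $1$). An edge $k$-coloring of $G$ is a function $\phi:E(G)\to\{1,2,\ldots,k\}$ such that any two incident edges (edges sharing an end vertex) receive different colors. For an edge coloring $\phi$ and a vertex $v$, $C_\phi(v)$ denotes the set of colors assigned by $\phi$ to the edges incident to $v$. The coloring $\phi$ is an adjacent vertex distinguishing edge coloring if $C_\phi(u)\neq C_\phi(v)$ for every pair of adjacent vertices $u,v$. For a normal graph $G$, the adjacent vertex distinguishing chromatic index $\chi'_a(G)$ is the smallest integer $k$ such that $G$ has an adjacent vertex distinguishing edge $k$-coloring. -}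

module Defs where

open import Data.Fin.Base as Fin using (Fin)
open import Data.Fin.Properties as Fin using ()
open import Data.Fin.Subset using (Subset; Nonempty; _∈_; ∣_∣)
open import Data.Nat.Base using (ℕ; _≤_)
open import Data.Product.Base using (∃-syntax; _×_)
open import Data.Sum.Base using (_⊎_)
open import Data.Vec.Properties.WithK using ([]=-irrelevant)
open import Level using (0ℓ)
open import Relation.Binary.PropositionalEquality.Core using (_≡_; _≢_; refl; cong₂)
open import Relation.Nullary using (¬_)
open import Relation.Unary using (Pred; _≐_)

record Graph : Set where
  field
    order         : ℕ
    neighbourhood : Fin order → Subset order

  Vertex : Set
  Vertex = Fin order

  Adjacent : Vertex → Vertex → Set
  Adjacent u v = v ∈ neighbourhood u

  field
    symmetric   : ∀ {u v} → Adjacent u v → Adjacent v u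
    no-loop     : ∀ {v} → ¬ Adjacent v v
    no-isolated : ∀ v → Nonempty (neighbourhood v)

  degree : Vertex → ℕ
  degree v = ∣ neighbourhood v ∣

  -- The edge {u , v} is stored with its smaller end vertex first, so each
  -- unordered pair of adjacent vertices is represented exactly once.
  record Edge : Set where
    eta-equality
    constructor edge
    field
      lo hi    : Vertex
      lo<hi    : lo Fin.< hi
      adjacent : Adjacent lo hi

  open Edge public

  -- Hence inequality of edges below is inequality of their end vertices.
  edge-≡ : ∀ {e f : Edge} → lo e ≡ lo f → hi e ≡ hi f → e ≡ f
  edge-≡ {edge u v p a} {edge _ _ q b} refl refl =
    cong₂ (edge u v) (Fin.<-irrelevant p q) ([]=-irrelevant a b)

  Incident : Vertex → Edge → Set
  Incident v e = v ≡ lo e ⊎ v ≡ hi e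

open Graph using (Vertex; Edge; Adjacent; Incident; degree)

Regular : Graph → ℕ → Set
Regular G r = ∀ v → degree G v ≡ r

module _ (G : Graph) {k : ℕ} (φ : Edge G → Fin k) where

  IsEdgeColoring : Set
  IsEdgeColoring = ∀ {e f v} → e ≢ f → Incident G v e → Incident G v f → φ e ≢ φ f

  ColorSet : Vertex G → Pred (Fin k) 0ℓ
  ColorSet v c = ∃[ e ] Incident G v e × φ e ≡ c

  -- _≐_ is extensional equality of sets of colors.
  IsAVDEdgeColoring : Set
  IsAVDEdgeColoring =
    IsEdgeColoring × (∀ {u v} → Adjacent G u v → ¬ (ColorSet u ≐ ColorSet v))

AVDEdgeColorable : Graph → ℕ → Set
AVDEdgeColorable G k = ∃[ φ ] IsAVDEdgeColoring G {k} φ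

-- IsAVDChromaticIndex G k says χ′ₐ(G) = k.  At most one k satisfies it, and
-- none does if G has an isolated edge, whose ends always have equal color
-- sets; so no normality hypothesis is needed here.
IsAVDChromaticIndex : Graph → ℕ → Set
IsAVDChromaticIndex G k =
  AVDEdgeColorable G k × (∀ m → AVDEdgeColorable G m → k ≤ m)

{-# OPTIONS --safe #-}
-- By Vizing's theorem the edges split into r + 1 matchings, and every vertex is missed by exactly
-- one of them.  Choose T of the matchings, T ~ log r, and replace the color of each by k new ones,
-- distributed over its edges; this costs r + 1 + (k − 1) T colors in all.  Adjacent vertices get
-- different color sets if some chosen matching covers exactly one of them, or both by edges of
-- different colors.  The matchings are treated one after the other.  Attach to each pair of
-- adjacent, still unseparated vertices a weight estimating the probability that random
-- choices in the remaining matchings never separate it.  A coloring of the current matching that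
-- is locally optimal for the total weight does not let the maximal weight at a vertex grow: at a
-- matching edge the mean over the k colors of the weight kept by the two ends is at most twice
-- that maximum divided by k, which is why a separable pair is charged 2/k, not 1/k, per
-- matching.  If the weight at each vertex is less than 1 initially, no pair survives.
-- With k = 4 this needs r + T − 1 < 2^(T−1), which leaves enough room except for r = 2 and r = 5,
-- where k = 5, T = 3 and k = 3, T = 6 do.
module Submission where

open import Defs
open import Data.Bool.Base using (Bool; true; false; if_then_else_; not; _∧_; _∨_; _xor_)
open import Data.Bool.Properties using (∧-comm; ∨-comm)
open import Data.Fin.Base as Fin using (Fin; zero; suc; toℕ; fromℕ<; _↑ˡ_; _↑ʳ_; splitAt; join; combine; remQuot; finToFun; funToFin)
open import Data.Fin.Properties as Fin using (_≟_; any?; all?; pigeonhole; toℕ≤pred[n]; toℕ-fromℕ<; 0≢1+n; suc-injective; splitAt-join; splitAt⁻¹-↑ˡ; splitAt-↑ˡ; combine-injective; remQuot-combine; finToFun-funToFin)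
open import Data.Fin.Subset using (Subset; _∈_; ∣_∣; _-_)
open import Data.Fin.Subset.Properties using (x∈p⇒∣p-x∣<∣p∣; x∈p∧x≢y⇒x∈p-y; _∈?_)
import Data.Integer.Properties as ℤ
open import Data.List.Base using (List; []; _∷_; _++_; _∷ʳ_; length; lookup; allFin; cartesianProduct)
open import Data.List.Membership.DecPropositional using () renaming (_∈?_ to mem?)
open import Data.List.Membership.Propositional using () renaming (_∈_ to _∈ₗ_; _∉_ to _∉ₗ_)
open import Data.List.Membership.Propositional.Properties using (∈-++⁺ˡ; ∈-++⁺ʳ; ∈-++⁻; ∈-∃++; ∈-allFin; ∈-cartesianProduct⁺; ∈-lookup)
open import Data.List.Properties using (length-++)
open import Data.List.Relation.Unary.Any using (here; there)
open import Data.Maybe.Base using (Maybe; just; nothing)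
open import Data.Maybe.Properties using (≡-dec; just-injective)
open import Data.Nat.Base as ℕ using (ℕ; zero; suc; _+_; _*_; _∸_; _^_; _<_; _≤_; _≥_; s≤s; z≤n)
open import Data.Nat.Induction using (<-wellFounded)
import Data.Nat.Properties as ℕ
open import Data.Nat.Tactic.RingSolver using (solve-∀)
open import Data.Product.Base using (∃; ∃-syntax; Σ-syntax; _×_; _,_; proj₁; proj₂)
open import Data.Rational.Base using (_/_) renaming (_≤_ to _≤ℚ_)
open import Data.Rational.Properties using (toℚᵘ-cancel-≤; toℚᵘ-fromℚᵘ)
open import Data.Rational.Unnormalised.Base using (mkℚᵘ; *≤*)
import Data.Rational.Unnormalised.Properties as ℚᵘ
open import Data.Sum.Base using (_⊎_; inj₁; inj₂; [_,_]′)
open import Data.Sum.Properties using (inj₁-injective)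
open import Data.Unit.Base using (⊤; tt)
open import Data.Vec.Base using ([]; _∷_)
open import Function.Base using (_∘_; const)
open import Function.Bundles using (_⇔_; mk⇔)
open import Function.Definitions using (Injective)
open import Induction.WellFounded using (Acc; acc)
open import Relation.Binary.Definitions using (tri<; tri≈; tri>)
open import Relation.Binary.PropositionalEquality
open import Relation.Nullary using (Dec; yes; no; does; ¬_; contradiction; ¬?)
open import Relation.Nullary.Decidable using (_×-dec_; _⊎-dec_; _→-dec_; map′; toSum; does-⇔; dec-true; dec-false; decidable-stable; from-yes)
open import Relation.Unary using (Decidable; _≐_; _⊆_)
open import Algebra.Properties.CommutativeSemigroup ℕ.*-commutativeSemigroup using (x∙yz≈y∙xz)
open import Algebra.Properties.Semiring.Sum ℕ.+-*-semiring using (sum; sum-cong-≗; ∑-distrib-+; ∑-comm; *-distribˡ-sum; sum-replicate-zero; sum-syntax)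

open Graph using (Vertex; Edge; Adjacent; Incident; degree; neighbourhood; edge; lo; hi)

-- Kempe chains

least : ∀ {p} {P : ℕ → Set p} → Decidable P → ∀ {n} → P n →
        ∃[ m ] P m × m ≤ n × (∀ {j} → P j → m ≤ j)
least P? {zero} p = 0 , p , z≤n , λ _ → z≤n
least {P = P} P? {suc n} p with P? 0
... | yes p₀ = 0 , p₀ , z≤n , λ _ → z≤n
... | no ¬p₀ with least {P = P ∘ suc} (P? ∘ suc) {n} p
...   | m , pm , m≤n , min = suc m , pm , s≤s m≤n , below
  where
  below : ∀ {j} → P j → suc m ≤ j
  below {zero}  pj = contradiction pj ¬p₀
  below {suc j} pj = s≤s (min pj)

-- The involutions stand for two color classes, and a fixed point is a vertex missing that color.
-- The Kempe chain starting at `x`, which misses the color of `α`, is the walk applying `β` and `α`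
-- in turn until a step does not move.
module AlternatingWalk {n : ℕ} (α β : Fin n → Fin n)
  (α-invol : ∀ v → α (α v) ≡ v) (β-invol : ∀ v → β (β v) ≡ v)
  (x : Fin n) (αx≡x : α x ≡ x) where

  step : ℕ → Fin n → Fin n
  step 0             = β
  step 1             = α
  step (suc (suc i)) = step i

  step-cases : ∀ i → (step i ≡ β × step (suc i) ≡ α) ⊎ (step i ≡ α × step (suc i) ≡ β)
  step-cases zero    = inj₁ (refl , refl)
  step-cases (suc i) = [ (λ (p , q) → inj₂ (q , p)) , (λ (p , q) → inj₁ (q , p)) ]′ (step-cases i)

  step-invol : ∀ i v → step i (step i v) ≡ v
  step-invol 0             = β-invol
  step-invol 1             = α-invol
  step-invol (suc (suc i)) = step-invol i

  step-periodic : ∀ p k → step (p * 2 + k) ≡ step k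
  step-periodic zero    k = refl
  step-periodic (suc p) k = step-periodic p k

  walk : ℕ → Fin n
  walk zero    = x
  walk (suc i) = step i (walk i)

  Stop : ℕ → Set
  Stop i = walk (suc i) ≡ walk i

  walk-back : ∀ i → step i (walk (suc i)) ≡ walk i
  walk-back i = step-invol i (walk i)

  -- Both walks can be run backwards together: an even shift does not change which involution is
  -- applied.
  walk-shift : ∀ p k → walk (p * 2 + k) ≡ walk k → walk (p * 2) ≡ x
  walk-shift p zero    eq = trans (cong walk (sym (ℕ.+-identityʳ (p * 2)))) eq
  walk-shift p (suc k) eq = walk-shift p k (begin
    walk (p * 2 + k)                              ≡⟨ walk-back (p * 2 + k) ⟨
    step (p * 2 + k) (walk (suc (p * 2 + k)))     ≡⟨ cong (λ f → f (walk (suc (p * 2 + k)))) (step-periodic p k) ⟩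
    step k (walk (suc (p * 2 + k)))               ≡⟨ cong (step k ∘ walk) (ℕ.+-suc (p * 2) k) ⟨
    step k (walk (p * 2 + suc k))                 ≡⟨ cong (step k) eq ⟩
    step k (walk (suc k))                         ≡⟨ walk-back k ⟩
    walk k                                        ∎)
    where open ≡-Reasoning

  -- The last step of such a return is `α`, which fixes `x`; so the walk was already at `x` one step
  -- earlier and stood still.
  stops-before-return : ∀ p → walk (suc p * 2) ≡ x → Stop (suc (p * 2))
  stops-before-return p eq = begin
    walk (suc p * 2)                        ≡⟨ eq ⟩
    x                                       ≡⟨ αx≡x ⟨
    α x                                     ≡⟨ cong α eq ⟨
    α (walk (suc p * 2))                    ≡⟨ cong (λ f → f (walk (suc p * 2))) α≡ ⟩
    step (suc (p * 2)) (walk (suc p * 2))   ≡⟨ walk-back (suc (p * 2)) ⟩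
    walk (suc (p * 2))                      ∎
    where
    open ≡-Reasoning
    α≡ : α ≡ step (suc (p * 2))
    α≡ = sym (trans (cong step (ℕ.+-comm 1 (p * 2))) (step-periodic p 1))

  stops : ∃ Stop
  -- Only the `n + 1` first even times are compared, so that the repetition found has an even
  -- period.
  stops with pigeonhole (ℕ.n<1+n n) (λ i → walk (toℕ i * 2))
  ... | i , j , i<j , eq = suc (d * 2) , stops-before-return d (walk-shift (suc d) (toℕ i * 2) (begin
    walk (suc d * 2 + toℕ i * 2)   ≡⟨ cong walk (ℕ.*-distribʳ-+ 2 (suc d) (toℕ i)) ⟨
    walk ((suc d + toℕ i) * 2)     ≡⟨ cong (λ m → walk (m * 2)) gap ⟩
    walk (toℕ j * 2)               ≡⟨ eq ⟨
    walk (toℕ i * 2)               ∎))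
    where
    open ≡-Reasoning
    d = toℕ j ∸ suc (toℕ i)
    gap : suc d + toℕ i ≡ toℕ j
    gap = trans (sym (ℕ.+-suc d (toℕ i))) (ℕ.m∸n+n≡m i<j)

  private
    first-stop = least {P = Stop} (λ i → walk (suc i) ≟ walk i) {n = proj₁ stops} (proj₂ stops)

  end : ℕ
  end = proj₁ first-stop

  end-stops : Stop end
  end-stops = proj₁ (proj₂ first-stop)

  end-least : ∀ {j} → Stop j → end ≤ j
  end-least = proj₂ (proj₂ (proj₂ first-stop))

  Visited : Fin n → Set
  Visited v = ∃[ i ] i ≤ end × walk i ≡ v

  visited? : Decidable Visited
  visited? v = map′
    (λ (i , eq) → toℕ i , toℕ≤pred[n] i , eq)
    (λ (i , i≤end , eq) → fromℕ< (s≤s i≤end) , trans (cong walk (toℕ-fromℕ< (s≤s i≤end))) eq)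
    (any? (λ (i : Fin (suc end)) → walk (toℕ i) ≟ v))

  visited-forward : ∀ {i} → i ≤ end → Visited (step i (walk i))
  visited-forward i≤end with ℕ.m≤n⇒m<n∨m≡n i≤end
  ... | inj₁ i<end = _ , i<end , refl
  ... | inj₂ refl  = end , ℕ.≤-refl , sym end-stops

  -- At a vertex after the start, one of the two involutions makes the next step and the other
  -- undoes the previous one.
  visited-closed : ∀ {v} → Visited v → Visited (α v) × Visited (β v)
  visited-closed (zero , i≤end , refl) = (0 , i≤end , sym αx≡x) , visited-forward i≤end
  visited-closed (suc i , i≤end , refl) with step-cases i | visited-forward i≤end | walk-back i
  ... | inj₁ (p , q) | fwd | back rewrite p | q = fwd , (i , ℕ.<⇒≤ i≤end , sym back)
  ... | inj₂ (p , q) | fwd | back rewrite p | q = (i , ℕ.<⇒≤ i≤end , sym back) , fwd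

  -- The chain is a path whose ends are `x` and `walk end`: a fixed point strictly between them
  -- would have stopped the walk before `end`, on arriving or on leaving.
  visited-fixed : ∀ {v} → v ≢ x → α v ≡ v ⊎ β v ≡ v → Visited v → v ≡ walk end
  visited-fixed v≢x fixed (zero , i≤end , refl) = contradiction refl v≢x
  visited-fixed v≢x fixed (suc i , i≤end , refl) with ℕ.m≤n⇒m<n∨m≡n i≤end
  ... | inj₂ eq    = cong walk eq
  ... | inj₁ i<end = contradiction fixed (not-fixed (step-cases i))
    where
    w = walk (suc i)
    fwd : step (suc i) w ≢ w
    fwd eq = ℕ.<⇒≱ i<end (end-least eq)
    bwd : step i w ≢ w
    bwd eq = ℕ.<⇒≱ (ℕ.<-trans (ℕ.n<1+n i) i<end) (end-least (trans (sym eq) (walk-back i)))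
    not-fixed : (step i ≡ β × step (suc i) ≡ α) ⊎ (step i ≡ α × step (suc i) ≡ β) → ¬ (α w ≡ w ⊎ β w ≡ w)
    not-fixed (inj₁ (p , q)) = [ subst (λ f → f w ≢ w) q fwd , subst (λ f → f w ≢ w) p bwd ]′
    not-fixed (inj₂ (p , q)) = [ subst (λ f → f w ≢ w) p bwd , subst (λ f → f w ≢ w) q fwd ]′

  chain : Fin n → Bool
  chain v = does (visited? v)

  private
    closed : (f : Fin n → Fin n) → (∀ v → f (f v) ≡ v) → (∀ {v} → Visited v → Visited (f v)) →
             ∀ v → chain (f v) ≡ chain v
    closed f f-invol f-closed v = does-⇔
      (mk⇔ (subst Visited (f-invol v) ∘ f-closed) f-closed) (visited? (f v)) (visited? v)

  chain-α : ∀ v → chain (α v) ≡ chain v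
  chain-α = closed α α-invol (proj₁ ∘ visited-closed)

  chain-β : ∀ v → chain (β v) ≡ chain v
  chain-β = closed β β-invol (proj₂ ∘ visited-closed)

  chain-start : chain x ≡ true
  chain-start = dec-true (visited? x) (0 , z≤n , refl)

  chain-avoids : ∀ {y z} → y ≢ x → z ≢ x → y ≢ z → α y ≡ y ⊎ β y ≡ y → α z ≡ z ⊎ β z ≡ z →
                 chain y ≡ false ⊎ chain z ≡ false
  chain-avoids {y} {z} y≢x z≢x y≢z fy fz = [ visited , inj₁ ∘ dec-false (visited? y) ]′ (toSum (visited? y))
    where
    visited : Visited y → chain y ≡ false ⊎ chain z ≡ false
    visited vy = inj₂ (dec-false (visited? z) λ vz →
      y≢z (trans (visited-fixed y≢x fy vy) (sym (visited-fixed z≢x fz vz))))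

-- Vizing's theorem

injection⇒≤∣∣ : ∀ {m n} (f : Fin m → Fin n) → Injective _≡_ _≡_ f →
                ∀ (p : Subset n) → (∀ i → f i ∈ p) → m ≤ ∣ p ∣
injection⇒≤∣∣ {zero}  f f-inj p f∈p = z≤n
injection⇒≤∣∣ {suc m} f f-inj p f∈p = ℕ.≤-trans
  (s≤s (injection⇒≤∣∣ (f ∘ suc) (suc-injective ∘ f-inj) (p - f zero)
    λ i → x∈p∧x≢y⇒x∈p-y (f∈p (suc i)) (0≢1+n ∘ sym ∘ f-inj)))
  (x∈p⇒∣p-x∣<∣p∣ (f∈p zero))

-- A proper partial edge coloring, given by one matching per color: mate c v is
-- the other end of the edge of color c at v, and v itself if there is none.
record Coloring (G : Graph) (K : ℕ) : Set where
  field
    mate            : Fin K → Vertex G → Vertex G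
    mate-involutive : ∀ c v → mate c (mate c v) ≡ v
    mate-adjacent   : ∀ c v → mate c v ≢ v → Adjacent G v (mate c v)
    mate-disjoint   : ∀ {c d} v → mate c v ≡ mate d v → mate c v ≢ v → c ≡ d

  Missing : Fin K → Vertex G → Set
  Missing c v = mate c v ≡ v

  Colored : Vertex G → Vertex G → Set
  Colored u v = ∃[ c ] mate c u ≡ v

  colored-sym : ∀ {u v} → Colored u v → Colored v u
  colored-sym (c , refl) = c , mate-involutive c _

  colored? : ∀ u v → Dec (Colored u v)
  colored? u v = any? (λ c → mate c u ≟ v)

  mate-swap : ∀ {c u v} → mate c u ≡ v → mate c v ≡ u
  mate-swap refl = mate-involutive _ _

open Coloring

-- Elementary changes of a partial coloring

module _ {G : Graph} {K : ℕ} where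

  infix 4 _⊑_
  _⊑_ : Coloring G K → Coloring G K → Set
  π ⊑ π′ = ∀ {u v} → u ≢ v → Colored π u v → Colored π′ u v

  missing-color : ∀ (π : Coloring G K) v → degree G v < K → ∃[ c ] Missing π c v
  missing-color π v deg<K with any? (λ c → mate π c v ≟ v)
  ... | yes found = found
  ... | no  none  = contradiction
    (injection⇒≤∣∣ (λ c → mate π c v) (λ {c} eq → mate-disjoint π v eq (none ∘ (c ,_)))
      (neighbourhood G v) λ c → mate-adjacent π c v (none ∘ (c ,_)))
    (ℕ.<⇒≱ deg<K)

  module Replace (π : Coloring G K) (c : Fin K) (ι : Vertex G → Vertex G)
    (ι-involutive : ∀ v → ι (ι v) ≡ v)
    (ι-adjacent : ∀ v → ι v ≢ v → Adjacent G v (ι v))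
    (ι-disjoint : ∀ d v → d ≢ c → ι v ≢ v → ι v ≢ mate π d v) where

    mate′ : Fin K → Vertex G → Vertex G
    mate′ d with d ≟ c
    ... | yes _ = ι
    ... | no  _ = mate π d

    replace : Coloring G K
    replace .mate = mate′
    replace .mate-involutive d v with d ≟ c
    ... | yes _ = ι-involutive v
    ... | no  _ = mate-involutive π d v
    replace .mate-adjacent d v with d ≟ c
    ... | yes _ = ι-adjacent v
    ... | no  _ = mate-adjacent π d v
    replace .mate-disjoint {d} {e} v eq moved with d ≟ c | e ≟ c
    ... | yes refl | yes refl = refl
    ... | yes refl | no  e≢c  = contradiction eq (ι-disjoint e v e≢c moved)
    ... | no  d≢c  | yes refl = contradiction (sym eq) (ι-disjoint d v d≢c (subst (_≢ v) eq moved))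
    ... | no  d≢c  | no  e≢c  = mate-disjoint π v eq moved

    replace-same : ∀ v → mate′ c v ≡ ι v
    replace-same v with c ≟ c
    ... | yes _  = refl
    ... | no c≢c = contradiction refl c≢c

    replace-other : ∀ {d} → d ≢ c → ∀ v → mate′ d v ≡ mate π d v
    replace-other {d} d≢c v with d ≟ c
    ... | yes d≡c = contradiction d≡c d≢c
    ... | no _    = refl

  module Uncolor (π : Coloring G K) (c : Fin K) (x : Vertex G) where

    private
      ι : Vertex G → Vertex G
      ι v with v ≟ x | v ≟ mate π c x
      ... | yes _ | _     = v
      ... | no  _ | yes _ = v
      ... | no  _ | no  _ = mate π c v

      ι-moved : ∀ v → ι v ≢ v → ι v ≡ mate π c v
      ι-moved v with v ≟ x | v ≟ mate π c x
      ... | yes _ | _     = contradiction refl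
      ... | no  _ | yes _ = contradiction refl
      ... | no  _ | no  _ = λ _ → refl

      ι-keep : ∀ {v} → v ≢ x → v ≢ mate π c x → ι v ≡ mate π c v
      ι-keep {v} v≢x v≢y with v ≟ x | v ≟ mate π c x
      ... | yes p | _     = contradiction p v≢x
      ... | no  _ | yes p = contradiction p v≢y
      ... | no  _ | no  _ = refl

      ι-x : ι x ≡ x
      ι-x with x ≟ x
      ... | yes _ = refl
      ... | no x≢x = contradiction refl x≢x

      ι-involutive : ∀ v → ι (ι v) ≡ v
      ι-involutive v with v ≟ x | v ≟ mate π c x
      ... | yes refl | _ = ι-x
      ... | no v≢x | yes refl with mate π c x ≟ x | mate π c x ≟ mate π c x
      ...   | yes _ | _     = refl
      ...   | no  _ | yes _ = refl
      ...   | no  _ | no ≢  = contradiction refl ≢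
      ι-involutive v | no v≢x | no v≢y = trans
        (ι-keep (λ eq → v≢y (sym (mate-swap π eq)))
                (λ eq → v≢x (trans (sym (mate-involutive π c v)) (mate-swap π (sym eq)))))
        (mate-involutive π c v)

    open Replace π c ι ι-involutive
      (λ v moved → subst (Adjacent G v) (sym (ι-moved v moved))
        (mate-adjacent π c v (moved ∘ trans (ι-moved v moved))))
      (λ d v d≢c moved eq → d≢c (sym (mate-disjoint π v (trans (sym (ι-moved v moved)) eq)
        (moved ∘ trans (ι-moved v moved)))))
      public using () renaming (replace to uncolor; replace-other to uncolor-other; replace-same to same)

    uncolor-missing : Missing uncolor c x
    uncolor-missing = trans (same x) ι-x

    uncolor-missing-other : ∀ v → Missing π c v → Missing uncolor c v
    uncolor-missing-other v miss with ι v ≟ v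
    ... | yes eq = trans (same v) eq
    ... | no neq = trans (same v) (trans (ι-moved v neq) miss)

    uncolor-colored : ∀ {u v} → u ≢ v → Colored π u v → ¬ (u ≡ x × v ≡ mate π c x) →
                      ¬ (u ≡ mate π c x × v ≡ x) → Colored uncolor u v
    uncolor-colored {u} {v} u≢v (d , eq) ¬xy ¬yx with d ≟ c
    ... | no d≢c   = d , trans (uncolor-other d≢c u) eq
    ... | yes refl = c , trans (same u) (trans (ι-keep
      (λ { refl → ¬xy (refl , sym eq) }) (λ { refl → ¬yx (refl , trans (sym eq) (mate-involutive π c x)) })) eq)

    uncolor-⊒ : ∀ {u v} → u ≢ v → Colored uncolor u v → Colored π u v
    uncolor-⊒ {u} u≢v (d , eq) with d ≟ c
    ... | no _     = d , eq
    ... | yes refl = c , trans (sym (ι-moved u (λ p → u≢v (trans (sym p) eq)))) eq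

    uncolor-uncolored : mate π c x ≢ x → ¬ Colored uncolor x (mate π c x)
    uncolor-uncolored y≢x (d , eq) with d ≟ c
    ... | yes refl = y≢x (trans (sym eq) ι-x)
    ... | no  d≢c  = d≢c (mate-disjoint π x eq (y≢x ∘ trans (sym eq)))

  module AddEdge (π : Coloring G K) (c : Fin K) {x y : Vertex G} (adj : Adjacent G x y)
    (new : ¬ Colored π x y) (cx : Missing π c x) (cy : Missing π c y) where

    private
      ι : Vertex G → Vertex G
      ι v with v ≟ x | v ≟ y
      ... | yes _ | _     = y
      ... | no  _ | yes _ = x
      ... | no  _ | no  _ = mate π c v

      x≢y : x ≢ y
      x≢y refl = Graph.no-loop G adj

      ι-x : ι x ≡ y
      ι-x with x ≟ x
      ... | yes _ = refl
      ... | no x≢x = contradiction refl x≢x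

      ι-y : ι y ≡ x
      ι-y with y ≟ x | y ≟ y
      ... | yes p | _ = p
      ... | no _  | yes _ = refl
      ... | no _ | no ≢ = contradiction refl ≢

      ι-keep : ∀ {v} → v ≢ x → v ≢ y → ι v ≡ mate π c v
      ι-keep {v} v≢x v≢y with v ≟ x | v ≟ y
      ... | yes p | _     = contradiction p v≢x
      ... | no  _ | yes p = contradiction p v≢y
      ... | no  _ | no  _ = refl

      ι-cases : ∀ v → (v ≡ x × ι v ≡ y) ⊎ (v ≡ y × ι v ≡ x) ⊎ (v ≢ x × v ≢ y × ι v ≡ mate π c v)
      ι-cases v with v ≟ x | v ≟ y
      ... | yes p | _     = inj₁ (p , refl)
      ... | no  _ | yes p = inj₂ (inj₁ (p , refl))
      ... | no  p | no  q = inj₂ (inj₂ (p , q , refl))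

      ι-involutive : ∀ v → ι (ι v) ≡ v
      ι-involutive v with ι-cases v
      ... | inj₁ (refl , eq) = trans (cong ι eq) ι-y
      ... | inj₂ (inj₁ (refl , eq)) = trans (cong ι eq) ι-x
      ... | inj₂ (inj₂ (v≢x , v≢y , eq)) = trans (cong ι eq) (trans
        (ι-keep (λ p → v≢x (trans (sym (mate-swap π p)) cx)) (λ p → v≢y (trans (sym (mate-swap π p)) cy)))
        (mate-involutive π c v))

      ι-adjacent : ∀ v → ι v ≢ v → Adjacent G v (ι v)
      ι-adjacent v moved with ι-cases v
      ... | inj₁ (refl , eq) = subst (Adjacent G x) (sym eq) adj
      ... | inj₂ (inj₁ (refl , eq)) = subst (Adjacent G y) (sym eq) (Graph.symmetric G adj)
      ... | inj₂ (inj₂ (_ , _ , eq)) = subst (Adjacent G v) (sym eq) (mate-adjacent π c v (moved ∘ trans eq))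

      ι-disjoint : ∀ d v → d ≢ c → ι v ≢ v → ι v ≢ mate π d v
      ι-disjoint d v d≢c moved eq′ with ι-cases v
      ... | inj₁ (refl , eq) = new (d , trans (sym eq′) eq)
      ... | inj₂ (inj₁ (refl , eq)) = new (d , mate-swap π (trans (sym eq′) eq))
      ... | inj₂ (inj₂ (_ , _ , eq)) = d≢c (sym (mate-disjoint π v (trans (sym eq) eq′) (moved ∘ trans eq)))

    open Replace π c ι ι-involutive ι-adjacent ι-disjoint
      public using () renaming (replace to add; replace-other to add-other; replace-same to same)

    add-uncolored : ∀ {w} → w ≢ y → ¬ Colored π x w → ¬ Colored add x w
    add-uncolored w≢y none (d , eq) with d ≟ c
    ... | yes refl = w≢y (trans (sym eq) ι-x)
    ... | no  _    = none (d , eq)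

    add-colors : Colored add x y
    add-colors = c , trans (same x) ι-x

    add-⊒ : π ⊑ add
    add-⊒ {u} {v} u≢v (d , eq) with d ≟ c
    ... | no d≢c   = d , trans (add-other d≢c u) eq
    ... | yes refl = c , trans (same u) (trans (ι-keep
      (λ { refl → u≢v (trans (sym cx) eq) }) (λ { refl → u≢v (trans (sym cy) eq) })) eq)

  -- Closed under both matchings, `S` is a union of components of the subgraph formed by the colors
  -- `a` and `b`; the two colors are exchanged on `S` only.
  module KempeSwap (π : Coloring G K) (a b : Fin K) (S : Vertex G → Bool)
    (S-a : ∀ v → S (mate π a v) ≡ S v) (S-b : ∀ v → S (mate π b v) ≡ S v) where

    σ : Bool → Fin K → Fin K
    σ false d = d
    σ true  d with d ≟ a | d ≟ b
    ... | yes _ | _     = b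
    ... | no  _ | yes _ = a
    ... | no  _ | no  _ = d

    σ-a : σ true a ≡ b
    σ-a with a ≟ a
    ... | yes _  = refl
    ... | no a≢a = contradiction refl a≢a

    σ-b : σ true b ≡ a
    σ-b with b ≟ a | b ≟ b
    ... | yes p | _     = p
    ... | no  _ | yes _ = refl
    ... | no  _ | no ≢  = contradiction refl ≢

    σ-other : ∀ s {d} → d ≢ a → d ≢ b → σ s d ≡ d
    σ-other false _ _ = refl
    σ-other true {d} d≢a d≢b with d ≟ a | d ≟ b
    ... | yes p | _     = contradiction p d≢a
    ... | no  _ | yes p = contradiction p d≢b
    ... | no  _ | no  _ = refl

    σ-involutive : ∀ s d → σ s (σ s d) ≡ d
    σ-involutive false d = refl
    σ-involutive true  d = by-cases (d ≟ a) (d ≟ b)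
      where
      by-cases : Dec (d ≡ a) → Dec (d ≡ b) → σ true (σ true d) ≡ d
      by-cases (yes refl) _          = trans (cong (σ true) σ-a) σ-b
      by-cases (no _)     (yes refl) = trans (cong (σ true) σ-b) σ-a
      by-cases (no d≢a)   (no d≢b)   = trans (cong (σ true) (σ-other true d≢a d≢b)) (σ-other true d≢a d≢b)

    private
      mate′ : Fin K → Vertex G → Vertex G
      mate′ d v = mate π (σ (S v) d) v

      -- The two ends of an edge of color `a` or `b` lie on the same side of `S`, so they agree on
      -- how this edge is recolored.
      σ-mate′ : ∀ d v → σ (S (mate′ d v)) d ≡ σ (S v) d
      σ-mate′ d v = by-cases (d ≟ a) (d ≟ b)
        where
        S-mate : ∀ s → d ≡ a ⊎ d ≡ b → S (mate π (σ s d) v) ≡ S v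
        S-mate false (inj₁ refl) = S-a v
        S-mate false (inj₂ refl) = S-b v
        S-mate true  (inj₁ refl) = trans (cong (λ e → S (mate π e v)) σ-a) (S-b v)
        S-mate true  (inj₂ refl) = trans (cong (λ e → S (mate π e v)) σ-b) (S-a v)
        by-cases : Dec (d ≡ a) → Dec (d ≡ b) → σ (S (mate′ d v)) d ≡ σ (S v) d
        by-cases (yes p) _         = cong (λ s → σ s d) (S-mate (S v) (inj₁ p))
        by-cases (no _)  (yes p)   = cong (λ s → σ s d) (S-mate (S v) (inj₂ p))
        by-cases (no d≢a) (no d≢b) = trans (σ-other (S (mate′ d v)) d≢a d≢b) (sym (σ-other (S v) d≢a d≢b))

    kempe-swap : Coloring G K
    kempe-swap .mate = mate′
    kempe-swap .mate-involutive d v =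
      trans (cong (λ e → mate π e (mate′ d v)) (σ-mate′ d v)) (mate-involutive π (σ (S v) d) v)
    kempe-swap .mate-adjacent d v = mate-adjacent π (σ (S v) d) v
    kempe-swap .mate-disjoint {d} {e} v eq moved =
      trans (sym (σ-involutive (S v) d))
        (trans (cong (σ (S v)) (mate-disjoint π v eq moved)) (σ-involutive (S v) e))

    swap-⊒ : π ⊑ kempe-swap
    swap-⊒ {u} _ (d , eq) = σ (S u) d , trans (cong (λ e → mate π e u) (σ-involutive (S u) d)) eq

    swap-⊑ : kempe-swap ⊑ π
    swap-⊑ {u} _ (d , eq) = σ (S u) d , eq

    swap-outside : ∀ d {v} → S v ≡ false → mate′ d v ≡ mate π d v
    swap-outside d {v} eq = cong (λ s → mate π (σ s d) v) eq

    swap-other : ∀ {d} → d ≢ a → d ≢ b → ∀ v → mate′ d v ≡ mate π d v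
    swap-other d≢a d≢b v = cong (λ e → mate π e v) (σ-other (S v) d≢a d≢b)

    swap-a : ∀ {v} → S v ≡ true → mate′ a v ≡ mate π b v
    swap-a {v} eq = cong (λ e → mate π e v) (trans (cong (λ s → σ s a) eq) σ-a)

    swap-b : ∀ {v} → S v ≡ true → mate′ b v ≡ mate π a v
    swap-b {v} eq = cong (λ e → mate π e v) (trans (cong (λ s → σ s b) eq) σ-b)

  -- One step of a fan rotation: the color `d` moves from the edge between `x` and `mate π d x` to
  -- the edge `x y`. The last component says that no other edge loses its color.
  shift : ∀ π {x y d} → Adjacent G x y → ¬ Colored π x y → Missing π d y → ¬ Missing π d x →
          ∃[ π′ ] (∀ {e} → e ≢ d → ∀ v → mate π′ e v ≡ mate π e v)
                × ¬ Colored π′ x (mate π d x)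
                × Colored π′ x y
                × (∀ {u v} → u ≢ v → Colored π u v → Colored π′ u v
                    ⊎ (u ≡ x × v ≡ mate π d x) ⊎ (u ≡ mate π d x × v ≡ x))
  shift π {x} {y} {d} adj new dy dx =
    add , (λ e≢d v → trans (add-other e≢d v) (uncolor-other e≢d v)) ,
    add-uncolored (λ eq → new (d , eq)) (uncolor-uncolored dx) , add-colors , keeps
    where
    x≢y : x ≢ y
    x≢y refl = Graph.no-loop G adj
    open Uncolor π d x
    open AddEdge uncolor d adj (new ∘ uncolor-⊒ x≢y) uncolor-missing (uncolor-missing-other y dy)
    keeps : ∀ {u v} → u ≢ v → Colored π u v → Colored add u v
            ⊎ (u ≡ x × v ≡ mate π d x) ⊎ (u ≡ mate π d x × v ≡ x)
    keeps {u} {v} u≢v col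
      with (u ≟ x) ×-dec (v ≟ mate π d x) | (u ≟ mate π d x) ×-dec (v ≟ x)
    ... | yes p | _     = inj₂ (inj₁ p)
    ... | no _  | yes p = inj₂ (inj₂ p)
    ... | no p  | no q  = inj₁ (add-⊒ u≢v (uncolor-colored u≢v col p q))

  -- In use, `x` misses `a`, while `y` and `z` miss `b`. The chain from `x` has only one other end,
  -- so either `y` keeps missing `b`, or `y` now misses `a` and `z` keeps missing `b`; this is
  -- `end-kept`.
  record KempeSwapped (π : Coloring G K) (a b : Fin K) (x y z : Vertex G) : Set where
    field
      swapped   : Coloring G K
      keeps     : π ⊑ swapped
      adds-none : swapped ⊑ π
      other     : ∀ {d} → d ≢ a → d ≢ b → ∀ v → mate swapped d v ≡ mate π d v
      at-x-a    : mate swapped a x ≡ mate π b x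
      at-x-b    : mate swapped b x ≡ mate π a x
      end-kept  : mate swapped b y ≡ mate π b y ⊎
                  (mate swapped a y ≡ mate π b y × mate swapped b z ≡ mate π b z)

  kempe : ∀ π {a b x y z} → Missing π a x → y ≢ x → z ≢ x → y ≢ z →
          Missing π b y → Missing π b z → KempeSwapped π a b x y z
  kempe π {a} {b} {x} {y} {z} ax y≢x z≢x y≢z by bz = record
    { swapped   = kempe-swap
    ; keeps     = swap-⊒
    ; adds-none = swap-⊑
    ; other     = swap-other
    ; at-x-a    = swap-a chain-start
    ; at-x-b    = swap-b chain-start
    ; end-kept  = cases (chain y) refl (chain-avoids y≢x z≢x y≢z (inj₂ by) (inj₂ bz))
    }
    where
    open AlternatingWalk (mate π a) (mate π b) (mate-involutive π a) (mate-involutive π b) x ax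
      using (chain; chain-α; chain-β; chain-start; chain-avoids)
    open KempeSwap π a b chain chain-α chain-β
    cases : ∀ s → chain y ≡ s → chain y ≡ false ⊎ chain z ≡ false →
            mate kempe-swap b y ≡ mate π b y ⊎
            (mate kempe-swap a y ≡ mate π b y × mate kempe-swap b z ≡ mate π b z)
    cases false out    _          = inj₁ (swap-outside b out)
    cases true  _      (inj₁ out) = inj₁ (swap-outside b out)
    cases true  inside (inj₂ out) = inj₂ (swap-a inside , swap-outside b out)

  -- Fans and their rotation

  module Fans (x : Vertex G) where

    -- A fan rotates: if x y is uncolored, y can take over the edge of color c, which
    -- leaves the edge from x to mate c x uncolored instead.
    Fan : Coloring G K → Vertex G → List (Fin K) → Set
    Fan π y []       = ⊤
    Fan π y (c ∷ cs) = Missing π c y × mate π c x ≢ x × c ∉ₗ cs × Fan π (mate π c x) cs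

    fan-end : Coloring G K → Vertex G → List (Fin K) → Vertex G
    fan-end π y []       = y
    fan-end π y (c ∷ cs) = fan-end π (mate π c x) cs

    fan-cong : ∀ π π′ cs {y} → (∀ {e} → e ∈ₗ cs → ∀ v → mate π′ e v ≡ mate π e v) →
               Fan π y cs → Fan π′ y cs × fan-end π′ y cs ≡ fan-end π y cs
    fan-cong π π′ []       same fan = tt , refl
    fan-cong π π′ (c ∷ cs) {y} same (cy , cx , c∉cs , fan) with fan-cong π π′ cs (same ∘ there) fan
    ... | fan′ , end≡ rewrite same (here refl) x =
      (trans (same (here refl) y) cy , cx , c∉cs , fan′) , end≡

    fan-∷ʳ : ∀ π cs {c y} → Fan π y cs → Missing π c (fan-end π y cs) → mate π c x ≢ x →
             c ∉ₗ cs → Fan π y (cs ∷ʳ c)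
    fan-∷ʳ π []       fan cy cx c∉cs = cy , cx , (λ ()) , tt
    fan-∷ʳ π (d ∷ cs) {c} (dy , dx , d∉cs , fan) cy cx c∉ = dy , dx , d∉ , fan-∷ʳ π cs fan cy cx (c∉ ∘ there)
      where
      d∉ : d ∉ₗ cs ∷ʳ c
      d∉ d∈ with ∈-++⁻ cs d∈
      ... | inj₁ d∈cs        = d∉cs d∈cs
      ... | inj₂ (here refl) = c∉ (here refl)

    fan-lookup-injective : ∀ π cs {y} → Fan π y cs → Injective _≡_ _≡_ (lookup cs)
    fan-lookup-injective π (c ∷ cs) fan              {zero}  {zero}  eq = refl
    fan-lookup-injective π (c ∷ cs) (_ , _ , c∉ , _) {zero}  {suc j} eq =
      contradiction (subst (_∈ₗ cs) (sym eq) (∈-lookup j)) c∉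
    fan-lookup-injective π (c ∷ cs) (_ , _ , c∉ , _) {suc i} {zero}  eq =
      contradiction (subst (_∈ₗ cs) eq (∈-lookup i)) c∉
    fan-lookup-injective π (c ∷ cs) (_ , _ , _ , fan) {suc i} {suc j} eq =
      cong suc (fan-lookup-injective π cs fan eq)

    fan-end≢x : ∀ π cs {y} → y ≢ x → Fan π y cs → fan-end π y cs ≢ x
    fan-end≢x π []       y≢x fan               = y≢x
    fan-end≢x π (c ∷ cs) y≢x (_ , cx , _ , fan) = fan-end≢x π cs cx fan

    fan-colors : ∀ π cs {y c} → Fan π y cs → c ∈ₗ cs → mate π c x ≢ x
    fan-colors π (c ∷ cs) (_ , cx , _ , fan) (here refl) = cx
    fan-colors π (c ∷ cs) (_ , _ , _ , fan)  (there c∈)  = fan-colors π cs fan c∈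

    fan-split : ∀ π cs {ds y c} → Fan π y (cs ++ c ∷ ds) →
                Fan π y cs × c ∉ₗ cs × Missing π c (fan-end π y cs)
    fan-split π []       (cy , _ , c∉ds , fan) = tt , (λ ()) , cy
    fan-split π (e ∷ cs) (ey , ex , e∉ , fan) with fan-split π cs fan
    ... | fan₁ , c∉cs , cend =
      (ey , ex , e∉ ∘ ∈-++⁺ˡ , fan₁) , (λ { (here refl) → e∉ (∈-++⁺ʳ cs (here refl)) ; (there c∈) → c∉cs c∈ }) , cend

    fan-end-mate : ∀ π c cs → ∃[ d ] d ∈ₗ c ∷ cs × fan-end π (mate π c x) cs ≡ mate π d x
    fan-end-mate π c []       = c , here refl , refl
    fan-end-mate π c (d ∷ cs) with fan-end-mate π d cs
    ... | e , e∈ , eq = e , there e∈ , eq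

    -- The fan vertices are distinct because the first is joined to `x` by no color of the fan and
    -- the others are mates of `x` in distinct colors. Hence the two fan vertices missing `c` can
    -- serve as `y` and `z` in `kempe`.
    fan-ends-differ : ∀ π cs {ds y c} → Fan π y (cs ++ c ∷ ds) →
                      (∀ {d} → d ∈ₗ cs ++ c ∷ ds → mate π d x ≢ y) →
                      fan-end π y cs ≢ fan-end π y (cs ++ c ∷ ds)
    fan-ends-differ π [] {ds} {y} {c} fan new eq with fan-end-mate π c ds
    ... | d , d∈ , end≡ = new d∈ (sym (trans eq end≡))
    fan-ends-differ π (e ∷ cs) (_ , ex , e∉ , fan) new = fan-ends-differ π cs fan λ d∈ eq →
      e∉ (subst (_∈ₗ _) (mate-disjoint π x eq (ex ∘ trans (sym eq))) d∈)

    -- When the swap turns the fan edge of color `c` at `x` into one of color `a`, and the fan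
    -- vertex before it misses `a`, putting `a` in the place of `c` gives a fan again.
    fan-replace : ∀ π π′ {a c} cs {ds y} → Fan π y (cs ++ c ∷ ds) → a ∉ₗ cs ++ c ∷ ds →
                  (∀ {e} → e ≢ a → e ≢ c → ∀ v → mate π′ e v ≡ mate π e v) →
                  mate π′ a x ≡ mate π c x → Missing π′ a (fan-end π y cs) →
                  Fan π′ y (cs ++ a ∷ ds) × fan-end π′ y (cs ++ a ∷ ds) ≡ fan-end π y (cs ++ c ∷ ds)
    fan-replace π π′ [] {ds} (_ , cx , c∉ds , fan) a∉ same ax ay
      with fan-cong π π′ ds (λ e∈ → same (λ { refl → a∉ (there e∈) }) (λ { refl → c∉ds e∈ })) fan
    ... | fan′ , end≡ rewrite ax = (ay , cx , a∉ ∘ there , fan′) , end≡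
    fan-replace π π′ {a} {c} (e ∷ cs) {ds} {y} (ey , ex , e∉ , fan) a∉ same ax ay
      with fan-replace π π′ cs fan (a∉ ∘ there) same ax ay
         | same {e} (λ { refl → a∉ (here refl) }) (λ { refl → e∉ (∈-++⁺ʳ cs (here refl)) })
    ... | fan′ , end≡ | e-same rewrite e-same x = (trans (e-same y) ey , ex , e∉′ , fan′) , end≡
      where
      e∉′ : e ∉ₗ cs ++ a ∷ ds
      e∉′ e∈ with ∈-++⁻ cs e∈
      ... | inj₁ e∈cs         = e∉ (∈-++⁺ˡ e∈cs)
      ... | inj₂ (here refl)  = a∉ (here refl)
      ... | inj₂ (there e∈ds) = e∉ (∈-++⁺ʳ cs (there e∈ds))

    -- Each `shift` colors the current edge and uncolors the edge to the next fan vertex, which the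
    -- recursion colors again. The last edge takes `c`, missing at both of its ends.
    rotate : ∀ π {y} cs {c} → Adjacent G x y → ¬ Colored π x y → Fan π y cs →
             Missing π c x → Missing π c (fan-end π y cs) → ∃[ π′ ] π ⊑ π′ × Colored π′ x y
    rotate π [] {c} adj new fan cx cy = add , add-⊒ , add-colors
      where open AddEdge π c adj new cx cy
    rotate π {y} (d ∷ cs) {c} adj new (dy , dx , d∉cs , fan) cx c-end
      with shift π adj new dy dx
    ... | π₁ , same , new₁ , xy , keeps
      with fan-cong π π₁ cs (λ e∈ → same λ { refl → d∉cs e∈ }) fan
    ... | fan₁ , end≡
      with rotate π₁ cs (mate-adjacent π d x dx) new₁ fan₁ (trans (same c≢d x) cx)
             (trans (cong (mate π₁ c) end≡) (trans (same c≢d _) (trans c-end (sym end≡))))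
      where
      c≢d : c ≢ d
      c≢d refl = dx cx
    ... | π′ , π₁⊑π′ , xz = π′ , π⊑π′ , π₁⊑π′ (λ { refl → Graph.no-loop G adj }) xy
      where
      π⊑π′ : π ⊑ π′
      π⊑π′ u≢v col with keeps u≢v col
      ... | inj₁ col₁                 = π₁⊑π′ u≢v col₁
      ... | inj₂ (inj₁ (refl , refl)) = xz
      ... | inj₂ (inj₂ (refl , refl)) = colored-sym π′ xz

    -- The fan cannot be extended since the color c missing at its end occurs in it. A Kempe
    -- swap of c with a color a missing at x makes c missing at x, and disturbs at most
    -- one of the two fan vertices that miss c.
    rotate-after-swap : ∀ π {y} cs {ds a c} → Adjacent G x y → ¬ Colored π x y → Fan π y (cs ++ c ∷ ds) →
                        Missing π a x → Missing π c (fan-end π y (cs ++ c ∷ ds)) →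
                        ∃[ π′ ] π ⊑ π′ × Colored π′ x y
    rotate-after-swap π {y} cs {ds} {a} {c} adj new fan ax c-end
      with fan-split π cs fan
    ... | fan₁ , c∉cs , c-end₁ = finish end-kept
      where
      x≢y : x ≢ y
      x≢y refl = Graph.no-loop G adj
      a∉ : a ∉ₗ cs ++ c ∷ ds
      a∉ a∈ = fan-colors π (cs ++ c ∷ ds) fan a∈ ax
      open KempeSwapped (kempe π ax (fan-end≢x π cs (x≢y ∘ sym) fan₁)
        (fan-end≢x π (cs ++ c ∷ ds) (x≢y ∘ sym) fan)
        (fan-ends-differ π cs fan λ {d} _ eq → new (d , eq)) c-end₁ c-end)
      Result : Coloring G K → Set
      Result π₀ = ∃[ π′ ] π₀ ⊑ π′ × Colored π′ x y
      conclude : Result swapped → Result π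
      conclude (π′ , ⊑π′ , xy) = π′ , (λ u≢v → ⊑π′ u≢v ∘ keeps u≢v) , xy
      rotate-swapped : ∀ es {v} → Fan swapped y es × fan-end swapped y es ≡ v →
                       mate swapped c v ≡ v → Result π
      rotate-swapped es (fan′ , refl) cv = conclude
        (rotate swapped es adj (new ∘ adds-none x≢y) fan′ (trans at-x-b ax) cv)
      finish : mate swapped c (fan-end π y cs) ≡ mate π c (fan-end π y cs) ⊎
               (mate swapped a (fan-end π y cs) ≡ mate π c (fan-end π y cs) ×
                mate swapped c (fan-end π y (cs ++ c ∷ ds)) ≡ mate π c (fan-end π y (cs ++ c ∷ ds))) →
               Result π
      -- The earlier of the two vertices still misses `c`. The fan up to it uses neither `a` nor
      -- `c`, so it survives the swap and can be rotated.
      finish (inj₁ out) = rotate-swapped cs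
        (fan-cong π swapped cs
          (λ e∈ → other (λ { refl → a∉ (∈-++⁺ˡ e∈) }) (λ { refl → c∉cs e∈ })) fan₁)
        (trans out c-end₁)
      -- The earlier vertex now misses `a`, and the fan edge after it has color `a`. The whole fan,
      -- with `a` for `c`, is rotated; its end still misses `c`.
      finish (inj₂ (inside , out)) = rotate-swapped (cs ++ a ∷ ds)
        (fan-replace π swapped cs fan a∉ other at-x-a (trans inside c-end₁))
        (trans out c-end)

    -- A fan is grown from `y`. Some color `c` is missing at its end: if `x` misses `c` too, the fan
    -- rotates; if `c` is new to the fan, it extends it; if `c` occurs in the fan, a Kempe swap
    -- comes before the rotation.
    color-edge : (∀ v → degree G v < K) → ∀ π {y} → Adjacent G x y → ¬ Colored π x y →
                 ∃[ π′ ] π ⊑ π′ × Colored π′ x y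
    color-edge deg<K π {y} adj new = grow (suc K) [] tt (ℕ.+-identityʳ (suc K))
      where
      grow : ∀ fuel cs → Fan π y cs → fuel + length cs ≡ suc K → ∃[ π′ ] π ⊑ π′ × Colored π′ x y
      -- Without fuel the fan would have `K + 1` colors, but they are distinct elements of `Fin K`.
      grow zero cs fan eq = contradiction
        (Fin.injective⇒≤ (fan-lookup-injective π cs fan))
        (ℕ.<⇒≱ (ℕ.≤-reflexive (sym eq)))
      grow (suc fuel) cs fan eq with missing-color π (fan-end π y cs) (deg<K _)
      ... | c , c-end with mate π c x ≟ x
      ...   | yes cx = rotate π cs adj new fan cx c-end
      ...   | no ¬cx with mem? _≟_ c cs
      ...     | no c∉cs = grow fuel (cs ∷ʳ c) (fan-∷ʳ π cs fan c-end ¬cx c∉cs)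
        (trans (cong (fuel +_) (trans (length-++ cs) (ℕ.+-comm (length cs) 1)))
          (trans (ℕ.+-suc fuel (length cs)) eq))
      ...     | yes c∈cs with ∈-∃++ c∈cs | missing-color π x (deg<K x)
      ...       | cs₁ , cs₂ , refl | a , ax = rotate-after-swap π cs₁ adj new fan ax c-end

empty-coloring : ∀ {G K} → Coloring G K
empty-coloring .mate c v                       = v
empty-coloring .mate-involutive c v            = refl
empty-coloring .mate-adjacent c v moved        = contradiction refl moved
empty-coloring .mate-disjoint v eq moved       = contradiction refl moved

vizing : ∀ G {K} → (∀ v → degree G v < K) →
         ∃[ π ] (∀ {u v} → Adjacent G u v → Colored {G} {K} π u v)
vizing G {K} deg<K with color-all (allPairs)
  where
  allPairs : List (Vertex G × Vertex G)
  allPairs = cartesianProduct (allFin _) (allFin _)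
  color-all : ∀ ps → ∃[ π ] (∀ {u v} → (u , v) ∈ₗ ps → Adjacent G u v → Colored {G} {K} π u v)
  color-all [] = empty-coloring , λ ()
  color-all ((x , y) ∷ ps) with color-all ps
  ... | π , done with y ∈? neighbourhood G x | colored? π x y
  ...   | no ¬adj | _ = π , λ { (here refl) adj → contradiction adj ¬adj ; (there p∈) → done p∈ }
  ...   | yes _ | yes col = π , λ { (here refl) _ → col ; (there p∈) → done p∈ }
  ...   | yes adj | no new with Fans.color-edge x deg<K π adj new
  ...     | π′ , π⊑π′ , xy = π′ , λ { (here refl) _ → xy
                                   ; (there p∈) adj → π⊑π′ (λ { refl → Graph.no-loop G adj }) (done p∈ adj) }
... | π , done = π , λ {u} {v} → done (∈-cartesianProduct⁺ (∈-allFin u) (∈-allFin v))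

-- Finite sums

sum-mono-≤ : ∀ {n} {f g : Fin n → ℕ} → (∀ i → f i ≤ g i) → sum f ≤ sum g
sum-mono-≤ {zero}  f≤g = z≤n
sum-mono-≤ {suc n} f≤g = ℕ.+-mono-≤ (f≤g zero) (sum-mono-≤ (f≤g ∘ suc))

term≤sum : ∀ {n} (f : Fin n → ℕ) i → f i ≤ sum f
term≤sum f zero    = ℕ.m≤m+n (f zero) _
term≤sum f (suc i) = ℕ.≤-trans (term≤sum (f ∘ suc) i) (ℕ.m≤n+m _ (f zero))

sum-zero : ∀ {n} {f : Fin n → ℕ} → (∀ i → f i ≡ 0) → sum f ≡ 0
sum-zero {n} f≡0 = trans (sum-cong-≗ f≡0) (sum-replicate-zero n)

⟦_⟧ : ∀ {p} {P : Set p} → Dec P → ℕ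
⟦ p? ⟧ = if does p? then 1 else 0

⟦⟧-yes : ∀ {p} {P : Set p} (p? : Dec P) → P → ⟦ p? ⟧ ≡ 1
⟦⟧-yes (yes _) p = refl
⟦⟧-yes (no ¬p) p = contradiction p ¬p

⟦⟧-no : ∀ {p} {P : Set p} (p? : Dec P) → ¬ P → ⟦ p? ⟧ ≡ 0
⟦⟧-no (yes p) ¬p = contradiction p ¬p
⟦⟧-no (no _)  ¬p = refl

⟦⟧-cong : ∀ {p q} {P : Set p} {Q : Set q} → P ⇔ Q → (p? : Dec P) (q? : Dec Q) → ⟦ p? ⟧ ≡ ⟦ q? ⟧
⟦⟧-cong P⇔Q p? q? = cong (λ b → if b then 1 else 0) (does-⇔ P⇔Q p? q?)

sum-single : ∀ {n} (f : Fin n → ℕ) i → (∀ j → j ≢ i → f j ≡ 0) → sum f ≡ f i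
sum-single f zero    f≡0 = trans (cong (f zero +_) (sum-zero λ j → f≡0 (suc j) λ ())) (ℕ.+-identityʳ _)
sum-single f (suc i) f≡0 = cong₂ _+_ (f≡0 zero λ ())
  (sum-single (f ∘ suc) i λ j j≢i → f≡0 (suc j) (j≢i ∘ Fin.suc-injective))

sum-two : ∀ {n} (f : Fin n → ℕ) {i j} → i ≢ j → (∀ l → l ≢ i → l ≢ j → f l ≡ 0) → sum f ≡ f i + f j
sum-two f {i} {j} i≢j f≡0 = begin
  sum f                                       ≡⟨ sum-cong-≗ (λ l → split l) ⟩
  sum (λ l → at-i l + off-i l)                ≡⟨ ∑-distrib-+ at-i off-i ⟩
  sum at-i + sum off-i                        ≡⟨ cong₂ _+_ (sum-single at-i i at-i-zero) (sum-single off-i j off-i-zero) ⟩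
  at-i i + off-i j                            ≡⟨ cong₂ _+_ at-i≡ off-i≡ ⟩
  f i + f j                                   ∎
  where
  open ≡-Reasoning
  at-i off-i : _ → ℕ
  at-i l  = if does (l ≟ i) then f l else 0
  off-i l = if does (l ≟ i) then 0 else f l
  split : ∀ l → f l ≡ at-i l + off-i l
  split l with l ≟ i
  ... | yes _ = sym (ℕ.+-identityʳ _)
  ... | no _  = refl
  at-i-zero : ∀ l → l ≢ i → at-i l ≡ 0
  at-i-zero l l≢i with l ≟ i
  ... | yes p = contradiction p l≢i
  ... | no _  = refl
  off-i-zero : ∀ l → l ≢ j → off-i l ≡ 0
  off-i-zero l l≢j with l ≟ i
  ... | yes _ = refl
  ... | no l≢i = f≡0 l l≢i l≢j
  at-i≡ : at-i i ≡ f i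
  at-i≡ with i ≟ i
  ... | yes _  = refl
  ... | no i≢i = contradiction refl i≢i
  off-i≡ : off-i j ≡ f j
  off-i≡ with j ≟ i
  ... | yes p = contradiction (sym p) i≢j
  ... | no _  = refl

const*≤sum : ∀ {n} c {f : Fin n → ℕ} → (∀ i → c ≤ f i) → n * c ≤ sum f
const*≤sum {zero}  c c≤f = z≤n
const*≤sum {suc n} c c≤f = ℕ.+-mono-≤ (c≤f zero) (const*≤sum c (c≤f ∘ suc))

module Cut {n} (q : Fin n → Bool) where

  cut : (Fin n → Fin n → ℕ) → ℕ
  cut g = ∑[ u < n ] ∑[ w < n ] (if q u ∧ not (q w) then g u w else 0)

  private
    cut′ rest : (Fin n → Fin n → ℕ) → ℕ
    cut′ g = ∑[ u < n ] ∑[ w < n ] (if not (q u) ∧ q w then g u w else 0)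
    rest g = ∑[ u < n ] ∑[ w < n ] (if q u xor q w then 0 else g u w)

    total : (Fin n → Fin n → ℕ) → ℕ
    total g = ∑[ u < n ] ∑[ w < n ] g u w

    ∑∑-distrib-+ : ∀ (f g : Fin n → Fin n → ℕ) → total (λ u w → f u w + g u w) ≡ total f + total g
    ∑∑-distrib-+ f g = trans (sum-cong-≗ λ u → ∑-distrib-+ (f u) (g u)) (∑-distrib-+ (sum ∘ f) (sum ∘ g))

    decompose : ∀ g → total g ≡ cut g + cut′ g + rest g
    decompose g = trans (sum-cong-≗ λ u → sum-cong-≗ λ w → pointwise (q u) (q w) (g u w))
      (trans (∑∑-distrib-+ _ _) (cong (_+ rest g) (∑∑-distrib-+ _ _)))
      where
      pointwise : ∀ a b m → m ≡ (if a ∧ not b then m else 0) + (if not a ∧ b then m else 0)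
                                + (if a xor b then 0 else m)
      pointwise true  true  m = refl
      pointwise true  false m = sym (trans (ℕ.+-identityʳ _) (ℕ.+-identityʳ m))
      pointwise false true  m = sym (ℕ.+-identityʳ m)
      pointwise false false m = refl

    -- By symmetry the two sides of the cut contribute equally.
    cut′≡cut : ∀ g → (∀ u w → g u w ≡ g w u) → cut′ g ≡ cut g
    cut′≡cut g g-sym = trans (∑-comm (λ u w → if not (q u) ∧ q w then g u w else 0)) (sum-cong-≗ λ w → sum-cong-≗ λ u →
      cong₂ (λ b m → if b then m else 0) (∧-comm (not (q u)) (q w)) (g-sym u w))

  -- The total is twice the cut plus the contribution of the pairs on one side, and the latter is
  -- the same for `g` and `h`.
  cut-decreases : ∀ {g h} → (∀ u w → g u w ≡ g w u) → (∀ u w → h u w ≡ h w u) →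
                  (∀ u w → q u ≡ q w → g u w ≡ h u w) → cut h < cut g → total h < total g
  cut-decreases {g} {h} g-sym h-sym agree h<g = begin-strict
    total h                  ≡⟨ decompose h ⟩
    cut h + cut′ h + rest h  ≡⟨ cong₂ (λ a b → cut h + a + b) (cut′≡cut h h-sym) rest≡ ⟩
    cut h + cut h + rest g   <⟨ ℕ.+-monoˡ-< (rest g) (ℕ.+-mono-< h<g h<g) ⟩
    cut g + cut g + rest g   ≡⟨ cong (λ a → cut g + a + rest g) (cut′≡cut g g-sym) ⟨
    cut g + cut′ g + rest g  ≡⟨ decompose g ⟨
    total g                  ∎
    where
    open ℕ.≤-Reasoning
    pointwise : ∀ a b {m m′ : ℕ} → (a ≡ b → m′ ≡ m) → (if a xor b then 0 else m) ≡ (if a xor b then 0 else m′)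
    pointwise true  true  e = sym (e refl)
    pointwise true  false e = refl
    pointwise false true  e = refl
    pointwise false false e = sym (e refl)
    rest≡ : rest h ≡ rest g
    rest≡ = sum-cong-≗ λ u → sum-cong-≗ λ w → pointwise (q u) (q w) (agree u w)

-- Separating adjacent vertices by recolored matchings

-- All that the color set of a vertex reveals about one recolored matching: whether it covers the
-- vertex and, if so, in which of its `k` colors.
key : ∀ {n k} → (Fin n → Fin n) → (Fin n → Fin k) → Fin n → Maybe (Fin k)
key π x v = if does (π v ≟ v) then nothing else just (x v)

-- A pair u w is never separated by a matching that misses both vertices or contains
-- the edge u w; otherwise a random k-coloring of the matching fails to separate it with
-- probability at most 1/k, and 2/k is charged since an edge has two ends.  All charges are
-- scaled by k.
factor : ∀ {n} → ℕ → (Fin n → Fin n) → Fin n → Fin n → ℕ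
factor k π u w = if (does (π u ≟ u) ∧ does (π w ≟ w)) ∨ does (π u ≟ w) then k else 2

Involution : ∀ {n} → (Fin n → Fin n) → Set
Involution π = ∀ v → π (π v) ≡ v

-- A vertex labeling constant on matching edges encodes a coloring of these edges.
Invariant : ∀ {n k} → (Fin n → Fin n) → (Fin n → Fin k) → Set
Invariant π x = ∀ v → x (π v) ≡ x v

factor-sym : ∀ {n} k (π : Fin n → Fin n) → Involution π → ∀ u w → factor k π u w ≡ factor k π w u
factor-sym k π inv u w = cong (λ b → if b then k else 2) (cong₂ _∨_
  (∧-comm (does (π u ≟ u)) _)
  (does-⇔ (mk⇔ (flip-mate u w) (flip-mate w u)) (π u ≟ w) (π w ≟ u)))
  where
  flip-mate : ∀ u w → π u ≡ w → π w ≡ u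
  flip-mate u _ refl = inv u

factor-partner : ∀ {n} k (π : Fin n → Fin n) u w → π u ≡ w → factor k π u w ≡ k
factor-partner k π u w eq with does (π u ≟ u) ∧ does (π w ≟ w)
... | true = refl
... | false rewrite dec-true (π u ≟ w) eq = refl

factor-uncovered : ∀ {n} k (π : Fin n → Fin n) u w → π u ≡ u → π w ≡ w → factor k π u w ≡ k
factor-uncovered k π u w uu ww rewrite dec-true (π u ≟ u) uu | dec-true (π w ≟ w) ww = refl

factor-covered : ∀ {n} k (π : Fin n → Fin n) u w → π u ≢ u → π u ≢ w → factor k π u w ≡ 2
factor-covered k π u w u≢ w≢ rewrite dec-false (π u ≟ u) u≢ | dec-false (π u ≟ w) w≢ = refl

key-covered : ∀ {n k} (π : Fin n → Fin n) (x : Fin n → Fin k) {v} → π v ≢ v → key π x v ≡ just (x v)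
key-covered π x {v} cov rewrite dec-false (π v ≟ v) cov = refl

key-uncovered : ∀ {n k} (π : Fin n → Fin n) (x : Fin n → Fin k) {v} → π v ≡ v → key π x v ≡ nothing
key-uncovered π x {v} unc rewrite dec-true (π v ≟ v) unc = refl

module _ {n k : ℕ} {π : Fin n → Fin n} (π-inv : Involution π)
  (ω : Fin n → Fin n → ℕ) (ω-sym : ∀ u w → ω u w ≡ ω w u) (ω-diag : ∀ u → ω u u ≡ 0) where

  _≟ₖ_ : (a b : Maybe (Fin k)) → Dec (a ≡ b)
  _≟ₖ_ = ≡-dec _≟_

  mono : (Fin n → Fin k) → Fin n → Fin n → ℕ
  mono x u w = ⟦ key π x u ≟ₖ key π x w ⟧ * ω u w

  mono-sym : ∀ x u w → mono x u w ≡ mono x w u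
  mono-sym x u w = cong₂ _*_
    (⟦⟧-cong (mk⇔ sym sym) (key π x u ≟ₖ key π x w) (key π x w ≟ₖ key π x u))
    (ω-sym u w)

  potential : (Fin n → Fin k) → ℕ
  potential x = ∑[ u < n ] ∑[ w < n ] mono x u w

  edge? : Fin n → Fin n → Bool
  edge? s v = does (v ≟ s) ∨ does (v ≟ π s)

  edge?-π : ∀ s v → edge? s (π v) ≡ edge? s v
  edge?-π s v = trans (cong₂ _∨_
    (does-⇔ (mk⇔ (λ { refl → sym (π-inv v) }) (λ { refl → π-inv s })) (π v ≟ s) (v ≟ π s))
    (does-⇔ (mk⇔ (λ eq → trans (sym (π-inv v)) (trans (cong π eq) (π-inv s))) (cong π)) (π v ≟ π s) (v ≟ s)))
    (∨-comm (does (v ≟ π s)) _)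

  edge?-left : ∀ s → edge? s s ≡ true
  edge?-left s rewrite dec-true (s ≟ s) refl = refl

  edge?-cases : ∀ s v → edge? s v ≡ true → v ≡ s ⊎ v ≡ π s
  edge?-cases s v eq with v ≟ s | v ≟ π s
  ... | yes p | _     = inj₁ p
  ... | no _  | yes p = inj₂ p

  edge?-off : ∀ s v → v ≢ s → v ≢ π s → edge? s v ≡ false
  edge?-off s v p q = cong₂ _∨_ (dec-false (v ≟ s) p) (dec-false (v ≟ π s) q)

  recolor : (Fin n → Fin k) → Fin n → Fin k → Fin n → Fin k
  recolor x s y v = if edge? s v then y else x v

  outer : Fin n → (Fin n → Fin n → ℕ) → Fin n → ℕ
  outer s g u = ∑[ w < n ] (if edge? s w then 0 else g u w)

  -- The total weight between the matching edge at `s` and the other vertices, which is all that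
  -- recoloring this edge can change.
  cost : Fin n → (Fin n → Fin n → ℕ) → ℕ
  cost s g = outer s g s + outer s g (π s)

  cut≡cost : ∀ {s} g → π s ≢ s → Cut.cut (edge? s) g ≡ cost s g
  cut≡cost {s} g cov = trans (sum-two row (cov ∘ sym) off) (cong₂ _+_ (on s (edge?-left s)) (on (π s) (trans (edge?-π s s) (edge?-left s))))
    where
    row : Fin n → ℕ
    row u = ∑[ w < n ] (if edge? s u ∧ not (edge? s w) then g u w else 0)
    if-not : ∀ b {m} → (if not b then m else 0) ≡ (if b then 0 else m)
    if-not true  = refl
    if-not false = refl
    on : ∀ u → edge? s u ≡ true → row u ≡ outer s g u
    on u eq = sum-cong-≗ λ w → trans (cong (λ b → if b ∧ not (edge? s w) then g u w else 0) eq) (if-not (edge? s w))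
    off : ∀ u → u ≢ s → u ≢ π s → row u ≡ 0
    off u u≢s u≢πs = sum-zero λ w → cong (λ b → if b ∧ not (edge? s w) then g u w else 0) (edge?-off s u u≢s u≢πs)

  LocallyOptimal : (Fin n → Fin k) → Set
  LocallyOptimal x = ∀ s y → π s ≢ s → cost s (mono x) ≤ cost s (mono (recolor x s y))

  recolor-invariant : ∀ {x : Fin n → Fin k} s y → Invariant π x → Invariant π (recolor x s y)
  recolor-invariant s y x-inv v = cong₂ (λ b z → if b then y else z) (edge?-π s v) (x-inv v)

  key-recolor-outside : ∀ x s y {v} → edge? s v ≡ false → key π (recolor x s y) v ≡ key π x v
  key-recolor-outside x s y {v} eq = cong (λ b → if does (π v ≟ v) then nothing else just (if b then y else x v)) eq

  key-recolor-inside : ∀ x s y {v} → π s ≢ s → edge? s v ≡ true → key π (recolor x s y) v ≡ just y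
  key-recolor-inside x s y {v} cov eq = trans (key-covered π (recolor x s y) covered) (cong (λ b → just (if b then y else x v)) eq)
    where
    covered : π v ≢ v
    covered eq′ with edge?-cases s v eq
    ... | inj₁ refl = cov eq′
    ... | inj₂ refl = cov (sym (trans (sym (π-inv s)) eq′))

  key-inside : ∀ {x : Fin n → Fin k} s {v} → Invariant π x → π s ≢ s → edge? s v ≡ true → key π x v ≡ just (x s)
  key-inside {x} s {v} x-inv cov eq with edge?-cases s v eq
  ... | inj₁ refl = key-covered π x cov
  ... | inj₂ refl = trans (key-covered π x (λ eq′ → cov (sym (trans (sym (π-inv s)) eq′)))) (cong just (x-inv s))

  recolor-agrees : ∀ {x : Fin n → Fin k} s y → Invariant π x → π s ≢ s → ∀ u w → edge? s u ≡ edge? s w →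
                   mono x u w ≡ mono (recolor x s y) u w
  recolor-agrees {x} s y x-inv cov u w eq = agree (edge? s w) eq refl
    where
    agree : ∀ b → edge? s u ≡ b → edge? s w ≡ b → mono x u w ≡ mono (recolor x s y) u w
    agree true u∈ w∈ = cong (_* ω u w) (trans
      (⟦⟧-yes (key π x u ≟ₖ key π x w) (trans (key-inside s x-inv cov u∈) (sym (key-inside s x-inv cov w∈))))
      (sym (⟦⟧-yes (key π (recolor x s y) u ≟ₖ key π (recolor x s y) w)
        (trans (key-recolor-inside x s y cov u∈) (sym (key-recolor-inside x s y cov w∈))))))
    agree false u∉ w∉ = sym (cong₂ (λ a b → ⟦ a ≟ₖ b ⟧ * ω u w)
      (key-recolor-outside x s y u∉) (key-recolor-outside x s y w∉))

  -- Lowering the cost of one matching edge lowers the potential, since pairs not cut by the edge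
  -- keep their weight: the keys of its two ends agree before and after, and the keys of other
  -- vertices do not change.
  local-search : ∀ x → Invariant π x → Acc _<_ (potential x) → ∃[ x′ ] Invariant π x′ × LocallyOptimal x′
  local-search x x-inv (acc rec)
    with any? (λ s → any? (λ y → ¬? (π s ≟ s) ×-dec (cost s (mono (recolor x s y)) ℕ.<? cost s (mono x))))
  ... | yes (s , y , cov , better) = local-search (recolor x s y) (recolor-invariant s y x-inv)
    (rec (Cut.cut-decreases (edge? s) {mono x} {mono (recolor x s y)} (mono-sym x) (mono-sym (recolor x s y))
      (recolor-agrees s y x-inv cov)
      (subst₂ _<_ (sym (cut≡cost _ cov)) (sym (cut≡cost _ cov)) better)))
  ... | no optimal = x , x-inv , λ s y cov → ℕ.≮⇒≥ λ better → optimal (s , y , cov , better)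

  -- A vertex off the edge shares its key with the edge for at most one of the `k` colors, so each
  -- pair contributes its weight at most once.
  outer-recolor : ∀ x s {u} → π s ≢ s → edge? s u ≡ true →
                  ∑[ y < k ] outer s (mono (recolor x s y)) u ≤ outer s ω u
  outer-recolor x s {u} cov u∈ = begin
    ∑[ y < k ] outer s (mono (recolor x s y)) u
      ≡⟨ ∑-comm (λ y w → if edge? s w then 0 else mono (recolor x s y) u w) ⟩
    ∑[ w < n ] ∑[ y < k ] (if edge? s w then 0 else mono (recolor x s y) u w)
      ≤⟨ sum-mono-≤ column ⟩
    outer s ω u ∎
    where
    open ℕ.≤-Reasoning
    one-color : ∀ m → ∑[ y < k ] ⟦ just y ≟ₖ m ⟧ ≤ 1
    one-color nothing  = ℕ.≤-trans (ℕ.≤-reflexive (sum-zero {k} λ y → refl)) z≤n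
    one-color (just z) = ℕ.≤-reflexive (trans
      (sum-single (λ y → ⟦ just y ≟ₖ just z ⟧) z (λ y y≢z → ⟦⟧-no (just y ≟ₖ just z) (y≢z ∘ just-injective)))
      (⟦⟧-yes (just z ≟ₖ just z) refl))
    uncut : ∀ w → edge? s w ≡ false → ∑[ y < k ] mono (recolor x s y) u w ≤ ω u w
    uncut w w∉ = begin
      ∑[ y < k ] mono (recolor x s y) u w
        ≡⟨ sum-cong-≗ (λ y → trans (cong₂ (λ a b → ⟦ a ≟ₖ b ⟧ * ω u w)
             (key-recolor-inside x s y cov u∈) (key-recolor-outside x s y w∉))
             (ℕ.*-comm _ (ω u w))) ⟩
      ∑[ y < k ] (ω u w * ⟦ just y ≟ₖ key π x w ⟧)
        ≡⟨ *-distribˡ-sum (ω u w) (λ y → ⟦ just y ≟ₖ key π x w ⟧) ⟨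
      ω u w * (∑[ y < k ] ⟦ just y ≟ₖ key π x w ⟧)
        ≤⟨ ℕ.*-monoʳ-≤ (ω u w) (one-color (key π x w)) ⟩
      ω u w * 1
        ≡⟨ ℕ.*-identityʳ _ ⟩
      ω u w ∎
    column : ∀ w → ∑[ y < k ] (if edge? s w then 0 else mono (recolor x s y) u w) ≤ (if edge? s w then 0 else ω u w)
    column w = masked (edge? s w) refl
      where
      masked : ∀ b → edge? s w ≡ b →
               ∑[ y < k ] (if b then 0 else mono (recolor x s y) u w) ≤ (if b then 0 else ω u w)
      masked true  _  = ℕ.≤-reflexive (sum-zero {k} λ y → refl)
      masked false w∉ = uncut w w∉

  -- Averaging: a locally optimal cost is at most the mean cost over the `k` colors for this edge.
  cost-bound : ∀ {x} → LocallyOptimal x → ∀ s → π s ≢ s → k * cost s (mono x) ≤ cost s ω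
  cost-bound {x} optimal s cov = begin
    k * cost s (mono x)                                  ≤⟨ const*≤sum {k} (cost s (mono x)) (λ y → optimal s y cov) ⟩
    ∑[ y < k ] cost s (mono (recolor x s y))             ≡⟨ ∑-distrib-+ {k} (λ y → outer s (mono (recolor x s y)) s) _ ⟩
    ∑[ y < k ] outer s (mono (recolor x s y)) s + ∑[ y < k ] outer s (mono (recolor x s y)) (π s)
      ≤⟨ ℕ.+-mono-≤ (outer-recolor x s cov (edge?-left s)) (outer-recolor x s cov (trans (edge?-π s s) (edge?-left s))) ⟩
    cost s ω ∎
    where open ℕ.≤-Reasoning

  -- The pair `u`, `π u` is never separated by this matching, so its whole weight has to be allowed
  -- for.
  matched-bound : ∀ x u → π u ≢ u → sum (mono x u) ≤ outer u (mono x) u + ω u (π u)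
  matched-bound x u cov = begin
    sum (mono x u)                                 ≡⟨ sum-cong-≗ (λ w → split (edge? u w) (mono x u w)) ⟩
    ∑[ w < n ] ((if edge? u w then 0 else mono x u w) + inner w)
      ≡⟨ ∑-distrib-+ (λ w → if edge? u w then 0 else mono x u w) inner ⟩
    outer u (mono x) u + sum inner                 ≡⟨ cong (outer u (mono x) u +_) (sum-two inner (cov ∘ sym) inner-off) ⟩
    outer u (mono x) u + (inner u + inner (π u))   ≤⟨ ℕ.+-monoʳ-≤ (outer u (mono x) u) (ℕ.+-mono-≤ inner-u inner-πu) ⟩
    outer u (mono x) u + ω u (π u)                 ∎
    where
    open ℕ.≤-Reasoning
    inner : Fin n → ℕ
    inner w = if edge? u w then mono x u w else 0
    split : ∀ b m → m ≡ (if b then 0 else m) + (if b then m else 0)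
    split true  m = refl
    split false m = sym (ℕ.+-identityʳ m)
    if-≤ : ∀ b {m} → (if b then m else 0) ≤ m
    if-≤ true  = ℕ.≤-refl
    if-≤ false = z≤n
    ⟦⟧*-≤ : ∀ {p} {P : Set p} (p? : Dec P) m → ⟦ p? ⟧ * m ≤ m
    ⟦⟧*-≤ (yes _) m = ℕ.≤-reflexive (ℕ.+-identityʳ m)
    ⟦⟧*-≤ (no _)  m = z≤n
    inner-≤ : ∀ w → inner w ≤ ω u w
    inner-≤ w = ℕ.≤-trans (if-≤ (edge? u w)) (⟦⟧*-≤ (key π x u ≟ₖ key π x w) (ω u w))
    inner-u : inner u ≤ 0
    inner-u = ℕ.≤-trans (inner-≤ u) (ℕ.≤-reflexive (ω-diag u))
    inner-πu : inner (π u) ≤ ω u (π u)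
    inner-πu = inner-≤ (π u)
    inner-off : ∀ w → w ≢ u → w ≢ π u → inner w ≡ 0
    inner-off w w≢u w≢πu = cong (λ b → if b then mono x u w else 0) (edge?-off u w w≢u w≢πu)

  charge : Fin n → ℕ
  charge u = ∑[ w < n ] (factor k π u w * ω u w)

  charge-covered : ∀ s {v} → π v ≢ v → edge? s v ≡ true → 2 * outer s ω v + k * ω v (π v) ≤ charge v
  charge-covered s {v} cov v∈ = begin
    2 * outer s ω v + k * ω v (π v)
      ≡⟨ cong₂ _+_ (*-distribˡ-sum 2 (λ w → if edge? s w then 0 else ω v w))
                   (sym (trans (sum-single partner (π v) partner-off) partner-on)) ⟩
    (∑[ w < n ] (2 * (if edge? s w then 0 else ω v w))) + sum partner
      ≡⟨ ∑-distrib-+ (λ w → 2 * (if edge? s w then 0 else ω v w)) partner ⟨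
    ∑[ w < n ] (2 * (if edge? s w then 0 else ω v w) + partner w)
      ≤⟨ sum-mono-≤ (λ w → pointwise w (w ≟ π v)) ⟩
    charge v ∎
    where
    open ℕ.≤-Reasoning
    partner : Fin n → ℕ
    partner w = if does (w ≟ π v) then k * ω v w else 0
    partner-off : ∀ w → w ≢ π v → partner w ≡ 0
    partner-off w w≢ = cong (λ b → if b then k * ω v w else 0) (dec-false (w ≟ π v) w≢)
    partner-on : partner (π v) ≡ k * ω v (π v)
    partner-on = cong (λ b → if b then k * ω v (π v) else 0) (dec-true (π v ≟ π v) refl)
    mask-≤ : ∀ b m → 2 * (if b then 0 else m) ≤ 2 * m
    mask-≤ true  m = z≤n
    mask-≤ false m = ℕ.≤-refl
    pointwise : ∀ w → Dec (w ≡ π v) → 2 * (if edge? s w then 0 else ω v w) + partner w ≤ factor k π v w * ω v w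
    pointwise w (yes refl) = ℕ.≤-reflexive (trans
      (cong₂ (λ b m → 2 * (if b then 0 else ω v w) + m) (trans (edge?-π s v) v∈) partner-on)
      (cong (_* ω v w) (sym (factor-partner k π v (π v) refl))))
    pointwise w (no w≢) = begin
      2 * (if edge? s w then 0 else ω v w) + partner w  ≡⟨ cong (2 * (if edge? s w then 0 else ω v w) +_) (partner-off w w≢) ⟩
      2 * (if edge? s w then 0 else ω v w) + 0          ≡⟨ ℕ.+-identityʳ _ ⟩
      2 * (if edge? s w then 0 else ω v w)              ≤⟨ mask-≤ (edge? s w) (ω v w) ⟩
      2 * ω v w                                         ≡⟨ cong (_* ω v w) (factor-covered k π v w cov (w≢ ∘ sym)) ⟨
      factor k π v w * ω v w                            ∎

  -- An uncovered `u` stays unseparated only from uncovered `w`, and there the factor is `k`.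
  charge-uncovered : ∀ x {u} → π u ≡ u → k * sum (mono x u) ≤ charge u
  charge-uncovered x {u} unc = begin
    k * sum (mono x u)                 ≡⟨ *-distribˡ-sum k (mono x u) ⟩
    ∑[ w < n ] (k * mono x u w)        ≤⟨ sum-mono-≤ (λ w → pointwise w (π w ≟ w)) ⟩
    charge u                           ∎
    where
    open ℕ.≤-Reasoning
    pointwise : ∀ w → Dec (π w ≡ w) → k * mono x u w ≤ factor k π u w * ω u w
    pointwise w (yes ww) = ℕ.≤-reflexive (cong₂ _*_
      (sym (factor-uncovered k π u w unc ww))
      (trans (cong (_* ω u w) (⟦⟧-yes (key π x u ≟ₖ key π x w)
        (trans (key-uncovered π x unc) (sym (key-uncovered π x ww))))) (ℕ.*-identityˡ _)))
    pointwise w (no ¬ww) = ℕ.≤-trans (ℕ.≤-reflexive (trans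
      (cong (λ m → k * (m * ω u w)) (⟦⟧-no (key π x u ≟ₖ key π x w) λ eq →
        nothing≢just (trans (sym (key-uncovered π x unc)) (trans eq (key-covered π x ¬ww)))))
      (ℕ.*-zeroʳ k))) z≤n
      where
      nothing≢just : ∀ {z : Fin k} → nothing ≢ just z
      nothing≢just ()

  -- The invariant of one round: a weight at each vertex below `k * M`, with the factor of this
  -- matching included, becomes a surviving weight below `M`. At a covered vertex the charges of
  -- both ends of its matching edge are added up.
  phase : ∀ M → Fin k → (∀ u → charge u < k * M) →
          ∃[ x ] Invariant π x × (∀ u → sum (mono x u) < M)
  phase M y₀ small with local-search (const y₀) (λ v → refl) (<-wellFounded _)
  ... | x , x-inv , optimal = x , x-inv , λ u → bound u (π u ≟ u)
    where
    bound : ∀ u → Dec (π u ≡ u) → sum (mono x u) < M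
    bound u (yes unc) = ℕ.*-cancelˡ-< k _ _ (ℕ.≤-<-trans (charge-uncovered x unc) (small u))
    bound u (no cov)  = ℕ.*-cancelˡ-< (2 * k) _ _ (begin-strict
      2 * k * sum (mono x u)
        ≤⟨ ℕ.*-monoʳ-≤ (2 * k) (matched-bound x u cov) ⟩
      2 * k * (outer u (mono x) u + p)
        -- The whole surviving cost of the edge might sit at the single end `u`. The charge 2
        -- instead of 1 pays for this loss.
        ≤⟨ ℕ.*-monoʳ-≤ (2 * k) (ℕ.+-monoˡ-≤ p (ℕ.m≤m+n _ (outer u (mono x) (π u)))) ⟩
      2 * k * (cost u (mono x) + p)
        ≡⟨ expand k (cost u (mono x)) p ⟩
      2 * (k * cost u (mono x)) + 2 * (k * p)
        ≤⟨ ℕ.+-monoˡ-≤ (2 * (k * p)) (ℕ.*-monoʳ-≤ 2 (cost-bound optimal u cov)) ⟩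
      2 * cost u ω + 2 * (k * p)
        ≡⟨ regroup (outer u ω u) (outer u ω (π u)) (k * p) ⟩
      (2 * outer u ω u + k * p) + (2 * outer u ω (π u) + k * p)
        ≤⟨ ℕ.+-mono-≤ (charge-covered u cov (edge?-left u)) charge-π ⟩
      charge u + charge (π u)
        <⟨ ℕ.+-mono-< (small u) (small (π u)) ⟩
      k * M + k * M
        ≡⟨ collect k M ⟩
      2 * k * M ∎)
      where
      open ℕ.≤-Reasoning
      p = ω u (π u)
      expand : ∀ k c p → 2 * k * (c + p) ≡ 2 * (k * c) + 2 * (k * p)
      expand = solve-∀
      regroup : ∀ a b q → 2 * (a + b) + 2 * q ≡ (2 * a + q) + (2 * b + q)
      regroup = solve-∀
      collect : ∀ k M → k * M + k * M ≡ 2 * k * M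
      collect = solve-∀
      charge-π : 2 * outer u ω (π u) + k * p ≤ charge (π u)
      charge-π = subst (λ q → 2 * outer u ω (π u) + k * q ≤ charge (π u))
        (trans (cong (ω (π u)) (π-inv u)) (ω-sym (π u) u))
        (charge-covered u (λ eq → cov (sym (trans (sym (π-inv u)) eq))) (trans (edge?-π u u) (edge?-left u)))

-- This is `k ^ T` times the estimated probability that none of the `T` matchings separates the
-- pair.
weight : ∀ {n T} → ℕ → (Fin T → Fin n → Fin n) → Fin n → Fin n → ℕ
weight {T = zero}  k πs u w = 1
weight {T = suc T} k πs u w = factor k (πs zero) u w * weight k (πs ∘ suc) u w

weight-sym : ∀ {n T} k (πs : Fin T → Fin n → Fin n) → (∀ i → Involution (πs i)) →
             ∀ u w → weight k πs u w ≡ weight k πs w u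
weight-sym {T = zero}  k πs inv u w = refl
weight-sym {T = suc T} k πs inv u w = cong₂ _*_ (factor-sym k (πs zero) (inv zero) u w) (weight-sym k (πs ∘ suc) (inv ∘ suc) u w)

-- `H` marks the pairs still to be separated. Each `phase` uses up one factor of the weight, sets
-- `H` to zero on the pairs just separated and divides the bound by `k`. When no matching is left,
-- the weight at each vertex is a natural number below 1, so `H` vanishes.
separate : ∀ {n T k} (πs : Fin T → Fin n → Fin n) → (∀ i → Involution (πs i)) → Fin k →
           (H : Fin n → Fin n → ℕ) → (∀ u w → H u w ≡ H w u) → (∀ u → H u u ≡ 0) →
           (∀ u → ∑[ w < n ] (weight k πs u w * H u w) < k ^ T) →
           Σ[ xs ∈ (Fin T → Fin n → Fin k) ] (∀ i → Invariant (πs i) (xs i)) ×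
                   (∀ u w → H u w ≢ 0 → ∃[ i ] key (πs i) (xs i) u ≢ key (πs i) (xs i) w)
separate {n} {zero} πs inv y₀ H H-sym H-diag small =
  (λ ()) , (λ ()) , λ u w H≢0 → contradiction (H≡0 u w) H≢0
  where
  H≡0 : ∀ u w → H u w ≡ 0
  H≡0 u w = ℕ.n≤0⇒n≡0 (ℕ.≤-trans (ℕ.≤-reflexive (sym (ℕ.*-identityˡ (H u w))))
    (ℕ.≤-trans (term≤sum (λ w → 1 * H u w) w) (ℕ.s≤s⁻¹ (small u))))
separate {n} {suc T} {k} πs inv y₀ H H-sym H-diag small
  with phase {π = π} (inv zero) (λ u w → ω u w * H u w)
         (λ u w → cong₂ _*_ (weight-sym k (πs ∘ suc) (inv ∘ suc) u w) (H-sym u w))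
         (λ u → trans (cong (ω u u *_) (H-diag u)) (ℕ.*-zeroʳ (ω u u)))
         (k ^ T) y₀
         (λ u → subst (_< k * k ^ T) (sum-cong-≗ λ w → ℕ.*-assoc (factor k π u w) (ω u w) (H u w)) (small u))
  where
  π = πs zero
  ω = weight k (πs ∘ suc)
... | x , x-inv , left
  with separate (πs ∘ suc) (inv ∘ suc) y₀
         (λ u w → ⟦ same? u w ⟧ * H u w)
         (λ u w → cong₂ _*_ (⟦⟧-cong (mk⇔ sym sym) (same? u w) (same? w u)) (H-sym u w))
         (λ u → trans (cong (⟦ same? u u ⟧ *_) (H-diag u)) (ℕ.*-zeroʳ ⟦ same? u u ⟧))
         (λ u → subst (_< k ^ T) (sum-cong-≗ λ w → x∙yz≈y∙xz ⟦ same? u w ⟧ (weight k (πs ∘ suc) u w) (H u w)) (left u))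
  where
  same? : ∀ u w → Dec (key (πs zero) x u ≡ key (πs zero) x w)
  same? u w = ≡-dec _≟_ (key (πs zero) x u) (key (πs zero) x w)
... | xs , xs-inv , sep = xs′ , xs′-inv , separated
  where
  xs′ : Fin (suc T) → Fin n → Fin k
  xs′ zero    = x
  xs′ (suc i) = xs i
  xs′-inv : ∀ i → Invariant (πs i) (xs′ i)
  xs′-inv zero    = x-inv
  xs′-inv (suc i) = xs-inv i
  separated : ∀ u w → H u w ≢ 0 → ∃[ i ] key (πs i) (xs′ i) u ≢ key (πs i) (xs′ i) w
  separated u w H≢0 with ≡-dec _≟_ (key (πs zero) x u) (key (πs zero) x w) | sep u w
  ... | no differ | _ = zero , differ
  ... | yes _     | sep′ with sep′ (H≢0 ∘ trans (sym (ℕ.+-identityʳ _)))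
  ...   | i , differ = suc i , differ

-- The initial charge

sum-∈?≡∣∣ : ∀ {n} (p : Subset n) → ∑[ v < n ] ⟦ v ∈? p ⟧ ≡ ∣ p ∣
sum-∈?≡∣∣ []            = refl
sum-∈?≡∣∣ (true  ∷ p) = cong suc (sum-∈?≡∣∣ p)
sum-∈?≡∣∣ (false ∷ p) = sum-∈?≡∣∣ p

sum-↑ : ∀ m {n} (f : Fin (m + n) → ℕ) → sum f ≡ sum (λ i → f (i ↑ˡ n)) + sum (λ i → f (m ↑ʳ i))
sum-↑ zero    f = refl
sum-↑ (suc m) f = trans (cong (f zero +_) (sum-↑ m (f ∘ suc))) (sym (ℕ.+-assoc (f zero) _ _))

⟦⟧≤1 : ∀ {p} {P : Set p} (p? : Dec P) → ⟦ p? ⟧ ≤ 1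
⟦⟧≤1 (yes _) = s≤s z≤n
⟦⟧≤1 (no _)  = z≤n

sum≤n : ∀ {n} {f : Fin n → ℕ} → (∀ i → f i ≤ 1) → sum f ≤ n
sum≤n {zero}  f≤1 = z≤n
sum≤n {suc n} f≤1 = ℕ.+-mono-≤ (f≤1 zero) (sum≤n (f≤1 ∘ suc))

covering missing : ∀ {n T} → (Fin T → Fin n → Fin n) → Fin n → ℕ
covering πs u = sum (λ i → ⟦ ¬? (πs i u ≟ u) ⟧)
missing  πs u = sum (λ i → ⟦ πs i u ≟ u ⟧)

missing+covering : ∀ {n T} (πs : Fin T → Fin n → Fin n) u → missing πs u + covering πs u ≡ T
missing+covering {T = zero}  πs u = refl
missing+covering {T = suc T} πs u with πs zero u ≟ u
... | yes _ = cong suc (missing+covering (πs ∘ suc) u)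
... | no _  = trans (ℕ.+-suc (missing (πs ∘ suc) u) _) (cong suc (missing+covering (πs ∘ suc) u))

module _ {n : ℕ} (j : ℕ) (u : Fin n) where

  private k = 2 + j

  factor-≤ : ∀ (π : Fin n → Fin n) w → factor k π u w ≤ k
  factor-≤ π w = bound _
    where
    bound : ∀ b → (if b then k else 2) ≤ k
    bound true  = ℕ.≤-refl
    bound false = s≤s (s≤s z≤n)

  weight-nonpartner : ∀ {T} (πs : Fin T → Fin n → Fin n) w → (∀ i → πs i u ≢ u → πs i u ≢ w) →
                      weight k πs u w ≤ k ^ missing πs u * 2 ^ covering πs u
  weight-nonpartner {zero}  πs w none = ℕ.≤-refl
  weight-nonpartner {suc T} πs w none = by-cases (πs zero u ≟ u)
    where
    m = missing (πs ∘ suc) u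
    c = covering (πs ∘ suc) u
    ih : weight k (πs ∘ suc) u w ≤ k ^ m * 2 ^ c
    ih = weight-nonpartner (πs ∘ suc) w (none ∘ suc)
    by-cases : (d : Dec (πs zero u ≡ u)) → weight k πs u w ≤ k ^ (⟦ d ⟧ + m) * 2 ^ (⟦ ¬? d ⟧ + c)
    by-cases (yes _)  = ℕ.≤-trans
      (ℕ.*-mono-≤ (factor-≤ (πs zero) w) ih)
      (ℕ.≤-reflexive (sym (ℕ.*-assoc k (k ^ m) (2 ^ c))))
    by-cases (no cov) = ℕ.≤-trans
      (ℕ.*-mono-≤ (ℕ.≤-reflexive (factor-covered k (πs zero) u w cov (none zero cov))) ih)
      (ℕ.≤-reflexive (x∙yz≈y∙xz 2 (k ^ m) (2 ^ c)))

  -- A pair has weight at most `k ^ missing πs u * 2 ^ covering πs u`, except that for a partner of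
  -- `u` one factor 2 becomes `2 + j`. Each of the `covering πs u` partners thus adds at most `j`
  -- times half of that bound; the doubling of both sides avoids the half.
  weight-total : ∀ {T} (πs : Fin T → Fin n → Fin n) →
                 (∀ {i i′} → πs i u ≡ πs i′ u → πs i u ≢ u → i ≡ i′) →
                 ∀ (H : Fin n → ℕ) → (∀ w → H w ≤ 1) →
                 2 * (∑[ w < n ] (weight k πs u w * H w)) ≤
                 k ^ missing πs u * (2 ^ covering πs u * (2 * sum H + covering πs u * j))
  weight-total {zero} πs disjoint H H≤1 = ℕ.≤-reflexive (begin
    2 * (∑[ w < n ] (1 * H w))             ≡⟨ cong (2 *_) (sum-cong-≗ (ℕ.*-identityˡ ∘ H)) ⟩
    2 * sum H                            ≡⟨ unit (sum H) ⟩
    1 * (1 * (2 * sum H + 0))            ∎)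
    where
    open ≡-Reasoning
    unit : ∀ s → 2 * s ≡ 1 * (1 * (2 * s + 0))
    unit = solve-∀
  weight-total {suc T} πs disjoint H H≤1 = by-cases (πs zero u ≟ u)
    where
    open ℕ.≤-Reasoning
    rest = πs ∘ suc
    tail-weight : Fin n → ℕ
    tail-weight w = weight k rest u w * H w
    ih : 2 * sum tail-weight ≤ k ^ missing rest u * (2 ^ covering rest u * (2 * sum H + covering rest u * j))
    ih = weight-total rest (λ eq moved → Fin.suc-injective (disjoint eq moved)) H H≤1
    m = missing rest u
    c = covering rest u
    Goal : ℕ → ℕ → Set
    Goal m′ c′ = 2 * (∑[ w < n ] (weight k πs u w * H w)) ≤ k ^ m′ * (2 ^ c′ * (2 * sum H + c′ * j))

    by-cases : (d : Dec (πs zero u ≡ u)) → Goal (⟦ d ⟧ + m) (⟦ ¬? d ⟧ + c)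
    by-cases (yes _) = begin
      2 * (∑[ w < n ] (weight k πs u w * H w))
        ≤⟨ ℕ.*-monoʳ-≤ 2 (sum-mono-≤ λ w → ℕ.≤-trans (ℕ.≤-reflexive (ℕ.*-assoc (factor k (πs zero) u w) _ (H w)))
             (ℕ.*-monoˡ-≤ (tail-weight w) (factor-≤ (πs zero) w))) ⟩
      2 * (∑[ w < n ] (k * tail-weight w))
        ≡⟨ cong (2 *_) (*-distribˡ-sum k tail-weight) ⟨
      2 * (k * sum tail-weight)
        ≡⟨ x∙yz≈y∙xz 2 k (sum tail-weight) ⟩
      k * (2 * sum tail-weight)
        ≤⟨ ℕ.*-monoʳ-≤ k ih ⟩
      k * (k ^ m * (2 ^ c * (2 * sum H + c * j)))
        ≡⟨ ℕ.*-assoc k (k ^ m) _ ⟨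
      k ^ suc m * (2 ^ c * (2 * sum H + c * j)) ∎
    by-cases (no cov) = begin
      2 * (∑[ w < n ] (weight k πs u w * H w))
        ≤⟨ ℕ.*-monoʳ-≤ 2 (sum-mono-≤ λ w → pointwise w (w ≟ πs zero u)) ⟩
      2 * (∑[ w < n ] (2 * tail-weight w + partner w))
        ≡⟨ cong (2 *_) (trans (∑-distrib-+ (λ w → 2 * tail-weight w) partner)
             (cong₂ _+_ (sym (*-distribˡ-sum 2 tail-weight))
               (trans (sum-single partner (πs zero u) λ w w≢ → cong (_* (j * tail-weight w)) (⟦⟧-no (w ≟ πs zero u) w≢))
                 (trans (cong (_* (j * tail-weight (πs zero u))) (⟦⟧-yes (πs zero u ≟ πs zero u) refl)) (ℕ.*-identityˡ _))))) ⟩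
      2 * (2 * sum tail-weight + j * tail-weight (πs zero u))
        ≤⟨ ℕ.*-monoʳ-≤ 2 (ℕ.+-mono-≤ ih (ℕ.*-monoʳ-≤ j partner-bound)) ⟩
      2 * (k ^ m * (2 ^ c * (2 * sum H + c * j)) + j * (k ^ m * 2 ^ c))
        ≡⟨ collect (k ^ m) (2 ^ c) (sum H) c j ⟩
      k ^ m * (2 ^ suc c * (2 * sum H + suc c * j)) ∎
      where
      partner : Fin n → ℕ
      partner w = ⟦ w ≟ πs zero u ⟧ * (j * tail-weight w)
      collect : ∀ a b h c j → 2 * (a * (b * (2 * h + c * j)) + j * (a * b)) ≡ a * (2 * b * (2 * h + suc c * j))
      collect = solve-∀
      split : ∀ j t → (2 + j) * t ≡ 2 * t + 1 * (j * t)
      split = solve-∀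
      pointwise : ∀ w → Dec (w ≡ πs zero u) → weight k πs u w * H w ≤ 2 * tail-weight w + partner w
      pointwise w (yes p) = begin
        factor k (πs zero) u w * weight k rest u w * H w ≡⟨ ℕ.*-assoc (factor k (πs zero) u w) _ (H w) ⟩
        factor k (πs zero) u w * tail-weight w           ≤⟨ ℕ.*-monoˡ-≤ (tail-weight w) (factor-≤ (πs zero) w) ⟩
        k * tail-weight w                                ≡⟨ split j (tail-weight w) ⟩
        2 * tail-weight w + 1 * (j * tail-weight w)      ≡⟨ cong (λ b → 2 * tail-weight w + b * (j * tail-weight w)) (⟦⟧-yes (w ≟ πs zero u) p) ⟨
        2 * tail-weight w + partner w                    ∎
      pointwise w (no w≢) = begin
        factor k (πs zero) u w * weight k rest u w * H w ≡⟨ ℕ.*-assoc (factor k (πs zero) u w) _ (H w) ⟩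
        factor k (πs zero) u w * tail-weight w           ≡⟨ cong (_* tail-weight w) (factor-covered k (πs zero) u w cov (w≢ ∘ sym)) ⟩
        2 * tail-weight w                                ≤⟨ ℕ.m≤m+n _ (partner w) ⟩
        2 * tail-weight w + partner w                    ∎
      -- By disjointness, the partner of `u` in the first matching is its partner in no later one.
      partner-bound : tail-weight (πs zero u) ≤ k ^ m * 2 ^ c
      partner-bound = begin
        weight k rest u (πs zero u) * H (πs zero u)
          ≤⟨ ℕ.*-mono-≤ (weight-nonpartner rest (πs zero u) λ i moved eq →
               Fin.0≢1+n (sym (disjoint eq moved))) (H≤1 (πs zero u)) ⟩
        k ^ m * 2 ^ c * 1
          ≡⟨ ℕ.*-identityʳ _ ⟩
        k ^ m * 2 ^ c ∎

-- T of the r + 1 matchings get 2 + j fresh colors each, the other q keep one color; c is the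
-- number of the T matchings that cover a given vertex, which is T or T - 1.
record Parameters (r : ℕ) : Set where
  constructor parameters
  field
    j T q   : ℕ
    count   : T + q ≡ suc r
    cheap   : 3 * (T * (2 + j) + q) ≤ 5 * r + 37
    enough  : ∀ c → c ≤ r → c ≤ T → T ≤ suc c → 2 ^ c * (2 * r + c * j) < 2 * (2 + j) ^ c

-- Arithmetic of the parameters

private
  -- The case `j = 2`, `T = suc t`. As `T + q` is `r + 1`, the bound on the number of colors becomes
  -- `9 * T ≤ 2 * r + 34`, and `enough` at `c = t` becomes `r + t < 2 ^ t`. The bound `3 ≤ r` is for
  -- the induction in steps of 9.
  FourColors : ℕ → Set
  FourColors r = ∃[ t ] ∃[ q ] t + q ≡ r × 9 * suc t ≤ 2 * r + 34 × r + t < 2 ^ t × 3 ≤ r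

  -- Raising `r` by 9 pays for exactly two more recolored matchings, as `9 * 2` is `2 * 9`, while
  -- `2 ^ t` quadruples.
  four-colors-step : ∀ {r} → FourColors r → FourColors (9 + r)
  four-colors-step {r} (t , q , count , cheap , enough , 3≤r) =
    2 + t , 7 + q , trans (assoc t q) (cong (9 +_) count) , cheap′ , enough′ , ℕ.≤-trans 3≤r (ℕ.m≤n+m r 9)
    where
    open ℕ.≤-Reasoning
    assoc : ∀ t q → 2 + t + (7 + q) ≡ 9 + (t + q)
    assoc = solve-∀
    cheap′ : 9 * suc (2 + t) ≤ 2 * (9 + r) + 34
    cheap′ = begin
      9 * suc (2 + t)     ≡⟨ lhs t ⟩
      18 + 9 * suc t      ≤⟨ ℕ.+-monoʳ-≤ 18 cheap ⟩
      18 + (2 * r + 34)   ≡⟨ rhs r ⟩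
      2 * (9 + r) + 34    ∎
      where
      lhs : ∀ t → 9 * suc (2 + t) ≡ 18 + 9 * suc t
      lhs = solve-∀
      rhs : ∀ r → 18 + (2 * r + 34) ≡ 2 * (9 + r) + 34
      rhs = solve-∀
    enough′ : 9 + r + (2 + t) < 2 ^ (2 + t)
    enough′ = begin-strict
      9 + r + (2 + t)             ≡⟨ lhs r t ⟩
      11 + (r + t)                <⟨ ℕ.+-monoˡ-< (r + t) (from-yes (11 ℕ.<? 4 + 3 * 3)) ⟩
      4 + 3 * 3 + (r + t)         ≤⟨ ℕ.+-monoˡ-≤ (r + t) (ℕ.+-monoʳ-≤ 4 (ℕ.*-monoʳ-≤ 3 (ℕ.≤-trans 3≤r (ℕ.m≤m+n r t)))) ⟩
      4 + 3 * (r + t) + (r + t)   ≡⟨ rhs (r + t) ⟩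
      2 * (2 * suc (r + t))       ≤⟨ ℕ.*-monoʳ-≤ 2 (ℕ.*-monoʳ-≤ 2 enough) ⟩
      2 ^ (2 + t)                 ∎
      where
      lhs : ∀ r t → 9 + r + (2 + t) ≡ 11 + (r + t)
      lhs = solve-∀
      rhs : ∀ m → 4 + 3 * m + m ≡ 2 * (2 * suc m)
      rhs = solve-∀

  -- There is one base case for each residue modulo 9: 3, 4, 6, 7, 8 directly, and 9, 10, 11, 14 in
  -- place of the exceptions 0, 1, 2, 5.
  four-colors : ∀ r → (r ≤ 2 ⊎ r ≡ 5) ⊎ FourColors r
  four-colors 0 = inj₁ (inj₁ z≤n)
  four-colors 1 = inj₁ (inj₁ (s≤s z≤n))
  four-colors 2 = inj₁ (inj₁ (s≤s (s≤s z≤n)))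
  four-colors 3 = inj₂ (3 , 0 , refl , from-yes (36 ℕ.≤? 40) , from-yes (6 ℕ.<? 8) , from-yes (3 ℕ.≤? 3))
  four-colors 4 = inj₂ (3 , 1 , refl , from-yes (36 ℕ.≤? 42) , from-yes (7 ℕ.<? 8) , from-yes (3 ℕ.≤? 4))
  four-colors 5 = inj₁ (inj₂ refl)
  four-colors 6 = inj₂ (4 , 2 , refl , from-yes (45 ℕ.≤? 46) , from-yes (10 ℕ.<? 16) , from-yes (3 ℕ.≤? 6))
  four-colors 7 = inj₂ (4 , 3 , refl , from-yes (45 ℕ.≤? 48) , from-yes (11 ℕ.<? 16) , from-yes (3 ℕ.≤? 7))
  four-colors 8 = inj₂ (4 , 4 , refl , from-yes (45 ℕ.≤? 50) , from-yes (12 ℕ.<? 16) , from-yes (3 ℕ.≤? 8))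
  four-colors (suc (suc (suc (suc (suc (suc (suc (suc (suc r))))))))) with four-colors r
  ... | inj₂ good                            = inj₂ (four-colors-step good)
  ... | inj₁ (inj₁ z≤n)                      = inj₂ (4 , 5 , refl , from-yes (45 ℕ.≤? 52) , from-yes (13 ℕ.<? 16) , from-yes (3 ℕ.≤? 9))
  ... | inj₁ (inj₁ (s≤s z≤n))                = inj₂ (4 , 6 , refl , from-yes (45 ℕ.≤? 54) , from-yes (14 ℕ.<? 16) , from-yes (3 ℕ.≤? 10))
  ... | inj₁ (inj₁ (s≤s (s≤s z≤n)))          = inj₂ (4 , 7 , refl , from-yes (45 ℕ.≤? 56) , from-yes (15 ℕ.<? 16) , from-yes (3 ℕ.≤? 11))
  ... | inj₁ (inj₂ refl)                     = inj₂ (5 , 9 , refl , from-yes (54 ℕ.≤? 62) , from-yes (19 ℕ.<? 32) , from-yes (3 ℕ.≤? 14))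

  four-powers : ∀ c → 4 ^ c ≡ 2 ^ c * 2 ^ c
  four-powers zero    = refl
  four-powers (suc c) = trans (cong (4 *_) (four-powers c)) (double (2 ^ c))
    where
    double : ∀ p → 4 * (p * p) ≡ 2 * p * (2 * p)
    double = solve-∀

  from-four-colors : ∀ {r} → FourColors r → Parameters r
  from-four-colors {r} (t , q , count , cheap , enough , _) = parameters 2 (suc t) q (cong suc count) cheap′ enough′
    where
    open ℕ.≤-Reasoning
    cheap′ : 3 * (suc t * 4 + q) ≤ 5 * r + 37
    cheap′ = begin
      3 * (suc t * 4 + q)            ≡⟨ lhs t q ⟩
      3 * suc (t + q) + 9 * suc t    ≡⟨ cong (λ m → 3 * suc m + 9 * suc t) count ⟩
      3 * suc r + 9 * suc t          ≤⟨ ℕ.+-monoʳ-≤ (3 * suc r) cheap ⟩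
      3 * suc r + (2 * r + 34)       ≡⟨ rhs r ⟩
      5 * r + 37                     ∎
      where
      lhs : ∀ t q → 3 * (suc t * 4 + q) ≡ 3 * suc (t + q) + 9 * suc t
      lhs = solve-∀
      rhs : ∀ r → 3 * suc r + (2 * r + 34) ≡ 5 * r + 37
      rhs = solve-∀
    grow : ∀ {c} → t ≤ c → c ≤ suc t → r + c < 2 ^ c
    grow {c} t≤c c≤1+t with ℕ.m≤n⇒m<n∨m≡n t≤c
    ... | inj₂ refl = enough
    ... | inj₁ t<c rewrite ℕ.≤-antisym c≤1+t t<c = begin-strict
      r + suc t        ≡⟨ ℕ.+-suc r t ⟩
      suc (r + t)      ≤⟨ enough ⟩
      2 ^ t            <⟨ ℕ.m<m+n (2 ^ t) (ℕ.≤-trans (ℕ.m^n>0 2 t) (ℕ.m≤m+n (2 ^ t) 0)) ⟩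
      2 ^ suc t        ∎
    enough′ : ∀ c → c ≤ r → c ≤ suc t → suc t ≤ suc c → 2 ^ c * (2 * r + c * 2) < 2 * 4 ^ c
    enough′ c _ c≤T T≤1+c = begin-strict
      2 ^ c * (2 * r + c * 2)   ≡⟨ lhs (2 ^ c) r c ⟩
      2 * (2 ^ c * (r + c))     <⟨ ℕ.*-monoʳ-< 2 (ℕ.*-monoʳ-< (2 ^ c) {{ℕ.m^n≢0 2 c}} (grow (ℕ.s≤s⁻¹ T≤1+c) c≤T)) ⟩
      2 * (2 ^ c * 2 ^ c)       ≡⟨ cong (2 *_) (four-powers c) ⟨
      2 * 4 ^ c                 ∎
      where
      lhs : ∀ p r c → p * (2 * r + c * 2) ≡ 2 * (p * (r + c))
      lhs = solve-∀

parameters-exist : ∀ r → r ≥ 2 → Parameters r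
parameters-exist r r≥2 with four-colors r
... | inj₂ good = from-four-colors good
-- For `r = 5` four colors just fail: `t = 3` would need `8 < 8`, and `t = 4` would need `45 ≤ 44`.
-- Instead all six matchings get three colors each; then `c = 5` at every vertex.
... | inj₁ (inj₂ refl) = parameters 1 6 0 refl (from-yes (54 ℕ.≤? 62)) enough
  where
  enough : ∀ c → c ≤ 5 → c ≤ 6 → 6 ≤ suc c → 2 ^ c * (10 + c * 1) < 2 * 3 ^ c
  enough c c≤5 _ 6≤1+c rewrite ℕ.≤-antisym c≤5 (ℕ.s≤s⁻¹ 6≤1+c) = from-yes (480 ℕ.<? 486)
-- For `r = 2` four colors fail even with `t = 2`, which would need `4 < 4`. All three matchings get
-- five colors each, so `c = 2` at every vertex.
... | inj₁ (inj₁ r≤2) rewrite ℕ.≤-antisym r≤2 r≥2 = parameters 3 3 0 refl (from-yes (45 ℕ.≤? 47)) enough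
  where
  enough : ∀ c → c ≤ 2 → c ≤ 3 → 3 ≤ suc c → 2 ^ c * (4 + c * 3) < 2 * 5 ^ c
  enough c c≤2 _ 3≤1+c rewrite ℕ.≤-antisym c≤2 (ℕ.s≤s⁻¹ 3≤1+c) = from-yes (40 ℕ.<? 50)

-- The edge coloring

Complete : ∀ {G K} → Coloring G K → Set
Complete {G} π = ∀ {u v} → Adjacent G u v → Colored π u v

module _ {G : Graph} {K : ℕ} (π : Coloring G K) (complete : Complete π) where

  -- Double counting of the pairs of a neighbor and a color joining `u` to it: completeness gives
  -- each neighbor a color, disjointness only one.
  covering≡degree : ∀ u → covering (mate π) u ≡ degree G u
  covering≡degree u = sym (begin
    degree G u                               ≡⟨ sum-∈?≡∣∣ (neighbourhood G u) ⟨
    ∑[ w < n ] ⟦ w ∈? neighbourhood G u ⟧    ≡⟨ sum-cong-≗ (λ w → row w (w ∈? neighbourhood G u)) ⟩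
    ∑[ w < n ] ∑[ c < K ] ⟦ joins? c w ⟧     ≡⟨ ∑-comm (λ w c → ⟦ joins? c w ⟧) ⟩
    ∑[ c < K ] ∑[ w < n ] ⟦ joins? c w ⟧     ≡⟨ sum-cong-≗ column ⟩
    covering (mate π) u                      ∎)
    where
    open ≡-Reasoning
    n = Graph.order G
    joins? : ∀ c w → Dec (mate π c u ≡ w × mate π c u ≢ u)
    joins? c w = (mate π c u ≟ w) ×-dec ¬? (mate π c u ≟ u)
    row : ∀ w → (d : Dec (Adjacent G u w)) → ⟦ d ⟧ ≡ ∑[ c < K ] ⟦ joins? c w ⟧
    row w (no ¬adj) = sym (sum-zero λ c → ⟦⟧-no (joins? c w) λ { (refl , moved) → ¬adj (mate-adjacent π c u moved) })
    row w (yes adj) with complete adj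
    ... | c , refl = sym (trans
      (sum-single (λ d → ⟦ joins? d w ⟧) c λ d d≢c → ⟦⟧-no (joins? d w) λ (eq , moved) → d≢c (mate-disjoint π u eq moved))
      (⟦⟧-yes (joins? c w) (refl , λ eq → Graph.no-loop G (subst (Adjacent G u) eq adj))))
    column : ∀ c → ∑[ w < n ] ⟦ joins? c w ⟧ ≡ ⟦ ¬? (mate π c u ≟ u) ⟧
    column c = by-cases (mate π c u ≟ u)
      where
      by-cases : (d : Dec (mate π c u ≡ u)) → ∑[ w < n ] ⟦ joins? c w ⟧ ≡ ⟦ ¬? d ⟧
      by-cases (yes fixed) = sum-zero λ w → ⟦⟧-no (joins? c w) λ (_ , moved) → moved fixed
      by-cases (no moved)  = trans
        (sum-single (λ w → ⟦ joins? c w ⟧) (mate π c u) λ w w≢ → ⟦⟧-no (joins? c w) (w≢ ∘ sym ∘ proj₁))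
        (⟦⟧-yes (joins? c (mate π c u)) (refl , moved))

module Recolor {G : Graph} {r : ℕ} (regular : Regular G r) (params : Parameters r) where
  open Parameters params

  k : ℕ
  k = 2 + j

  private
    n = Graph.order G

    base : Σ[ π ∈ Coloring G (T + q) ] Complete π
    base = vizing G λ v → subst₂ _<_ (sym (regular v)) (sym count) (ℕ.n<1+n r)

  abstract
    π : Coloring G (T + q)
    π = proj₁ base

    π-complete : Complete π
    π-complete = proj₂ base

  used : Fin T → Vertex G → Vertex G
  used i = mate π (i ↑ˡ q)

  adjacency : Vertex G → Vertex G → ℕ
  adjacency u w = ⟦ w ∈? neighbourhood G u ⟧

  -- Exactly `r` of the `r + 1` matchings cover `u`, so at most one of the `T` recolored ones misses
  -- it.
  covering-used : ∀ u → covering used u ≤ r × T ≤ suc (covering used u)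
  covering-used u = ℕ.≤-trans (ℕ.m≤m+n _ rest) (ℕ.≤-reflexive split) ,
    ℕ.+-cancelʳ-≤ q T _ (begin
      T + q                          ≡⟨ count ⟩
      suc r                          ≡⟨ cong suc split ⟨
      suc (covering used u + rest)   ≤⟨ ℕ.+-monoʳ-≤ (suc (covering used u)) (sum≤n λ i → ⟦⟧≤1 (¬? (mate π (T ↑ʳ i) u ≟ u))) ⟩
      suc (covering used u) + q      ∎)
    where
    open ℕ.≤-Reasoning
    rest = sum (λ i → ⟦ ¬? (mate π (T ↑ʳ i) u ≟ u) ⟧)
    split : covering used u + rest ≡ r
    split = trans (sym (sum-↑ T (λ c → ⟦ ¬? (mate π c u ≟ u) ⟧)))
      (trans (covering≡degree π π-complete u) (regular u))

  -- The bound of `weight-total` with `r` neighbors; after cancelling the powers of `k` for the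
  -- matchings missing `u`, it is the inequality `enough`.
  small : ∀ u → ∑[ w < n ] (weight k used u w * adjacency u w) < k ^ T
  small u = ℕ.*-cancelˡ-< 2 _ _ (begin-strict
    2 * (∑[ w < n ] (weight k used u w * adjacency u w))
      ≤⟨ weight-total j u used used-disjoint (adjacency u) (λ w → ⟦⟧≤1 (w ∈? neighbourhood G u)) ⟩
    k ^ m * (2 ^ c * (2 * sum (adjacency u) + c * j))
      ≡⟨ cong (λ s → k ^ m * (2 ^ c * (2 * s + c * j))) (trans (sum-∈?≡∣∣ (neighbourhood G u)) (regular u)) ⟩
    k ^ m * (2 ^ c * (2 * r + c * j))
      <⟨ ℕ.*-monoʳ-< (k ^ m) {{ℕ.m^n≢0 k m}} (enough c (proj₁ (covering-used u)) c≤T (proj₂ (covering-used u))) ⟩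
    k ^ m * (2 * k ^ c)
      ≡⟨ x∙yz≈y∙xz (k ^ m) 2 (k ^ c) ⟩
    2 * (k ^ m * k ^ c)
      ≡⟨ cong (2 *_) (ℕ.^-distribˡ-+-* k m c) ⟨
    2 * k ^ (m + c)
      ≡⟨ cong (λ t → 2 * k ^ t) (missing+covering used u) ⟩
    2 * k ^ T ∎)
    where
    open ℕ.≤-Reasoning
    m = missing used u
    c = covering used u
    c≤T : c ≤ T
    c≤T = subst (c ≤_) (missing+covering used u) (ℕ.m≤n+m c m)
    used-disjoint : ∀ {i i′} → used i u ≡ used i′ u → used i u ≢ u → i ≡ i′
    used-disjoint eq moved = Fin.↑ˡ-injective q _ _ (mate-disjoint π u eq moved)

  private
    separation : Σ[ xs ∈ (Fin T → Vertex G → Fin k) ] (∀ i → Invariant (used i) (xs i)) ×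
                 (∀ u w → adjacency u w ≢ 0 → ∃[ i ] key (used i) (xs i) u ≢ key (used i) (xs i) w)
    separation = separate used (λ i → mate-involutive π (i ↑ˡ q)) zero adjacency
      (λ u w → ⟦⟧-cong (mk⇔ (Graph.symmetric G) (Graph.symmetric G)) (w ∈? neighbourhood G u) (u ∈? neighbourhood G w))
      (λ u → ⟦⟧-no (u ∈? neighbourhood G u) (Graph.no-loop G))
      small

  abstract
    label : Fin T → Vertex G → Fin k
    label = proj₁ separation

    label-invariant : ∀ i → Invariant (used i) (label i)
    label-invariant = proj₁ (proj₂ separation)

    label-separates : ∀ {u w} → Adjacent G u w → ∃[ i ] key (used i) (label i) u ≢ key (used i) (label i) w
    label-separates {u} {w} adj = proj₂ (proj₂ separation) u w λ eq →
      ℕ.1+n≢0 (trans (sym (⟦⟧-yes (w ∈? neighbourhood G u) adj)) eq)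

  -- The new palette consists of `T` blocks of `k` colors, one per recolored matching, and `q`
  -- single colors.
  slot : Vertex G → Fin T ⊎ Fin q → Fin (T * k) ⊎ Fin q
  slot v (inj₁ i) = inj₁ (combine i (label i v))
  slot v (inj₂ i) = inj₂ i

  paint : Fin (T + q) → Vertex G → Fin (T * k + q)
  paint c v = join (T * k) q (slot v (splitAt T c))

  slot-injective : ∀ {v w} s t → slot v s ≡ slot w t → s ≡ t
  slot-injective (inj₁ i) (inj₁ i′) eq = cong inj₁ (proj₁ (combine-injective i _ i′ _ (inj₁-injective eq)))
  slot-injective (inj₁ _) (inj₂ _) ()
  slot-injective (inj₂ _) (inj₁ _) ()
  slot-injective (inj₂ _) (inj₂ _) refl = refl

  paint-slot : ∀ {c d v w} → paint c v ≡ paint d w → slot v (splitAt T c) ≡ slot w (splitAt T d)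
  paint-slot {c} {d} {v} {w} eq = trans (sym (splitAt-join (T * k) q _))
    (trans (cong (splitAt (T * k)) eq) (splitAt-join (T * k) q _))

  paint-color : ∀ {c d v w} → paint c v ≡ paint d w → c ≡ d
  paint-color {c} {d} eq = trans (sym (Fin.join-splitAt T q c))
    (trans (cong (join T q) (slot-injective _ _ (paint-slot {c} {d} eq))) (Fin.join-splitAt T q d))

  paint-label : ∀ {i v w} → paint (i ↑ˡ q) v ≡ paint (i ↑ˡ q) w → label i v ≡ label i w
  paint-label {i} {v} {w} eq with splitAt T (i ↑ˡ q) | splitAt-↑ˡ T i q | paint-slot {i ↑ˡ q} {i ↑ˡ q} eq
  ... | inj₁ _ | refl | slots = proj₂ (combine-injective i (label i v) i (label i w) (inj₁-injective slots))

  paint-mate : ∀ c v → paint c (mate π c v) ≡ paint c v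
  paint-mate c v with splitAt T c in eq
  ... | inj₂ i = refl
  ... | inj₁ i = cong (λ l → join (T * k) q (inj₁ (combine i l)))
    (trans (cong (λ d → label i (mate π d v)) (sym (splitAt⁻¹-↑ˡ eq))) (label-invariant i v))

  color : Edge G → Fin (T + q)
  color e = proj₁ (π-complete (Edge.adjacent e))

  mate-lo : ∀ e → mate π (color e) (lo e) ≡ hi e
  mate-lo e = proj₂ (π-complete (Edge.adjacent e))

  mate-hi : ∀ e → mate π (color e) (hi e) ≡ lo e
  mate-hi e = mate-swap π (mate-lo e)

  -- The label is read at the lower end, but by invariance the upper end gives the same color; see
  -- `φ-at`.
  φ : Edge G → Fin (T * k + q)
  φ e = paint (color e) (lo e)

  lo≢hi : ∀ (e : Edge G) → lo e ≢ hi e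
  lo≢hi e eq = Fin.<-irrefl eq (Edge.lo<hi e)

  incident-moved : ∀ {v e} → Incident G v e → mate π (color e) v ≢ v
  incident-moved {e = e} (inj₁ refl) eq = lo≢hi e (trans (sym eq) (mate-lo e))
  incident-moved {e = e} (inj₂ refl) eq = lo≢hi e (trans (sym (mate-hi e)) eq)

  φ-at : ∀ {v e} → Incident G v e → φ e ≡ paint (color e) v
  φ-at {e = e} (inj₁ refl) = refl
  φ-at {e = e} (inj₂ refl) = trans (cong (paint (color e)) (sym (mate-hi e))) (paint-mate (color e) (hi e))

  edge-at : ∀ {c v} → mate π c v ≢ v → ∃[ e ] Incident G v e × color e ≡ c
  edge-at {c} {v} moved with Fin.<-cmp v (mate π c v)
  ... | tri< v<w _ _ = e , inj₁ refl , mate-disjoint π v (mate-lo e) (incident-moved {e = e} (inj₁ refl))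
    where e = edge v (mate π c v) v<w (mate-adjacent π c v moved)
  ... | tri≈ _ v≡w _ = contradiction (sym v≡w) moved
  ... | tri> _ _ w<v = e , inj₂ refl , mate-disjoint π v (mate-hi e) (incident-moved {e = e} (inj₂ refl))
    where e = edge (mate π c v) v w<v (Graph.symmetric G (mate-adjacent π c v moved))

  proper : IsEdgeColoring G φ
  proper {e} {f} {v} e≢f ve vf eq = e≢f (same-edge ve vf)
    where
    same-color : color e ≡ color f
    same-color = paint-color (trans (sym (φ-at {e = e} ve)) (trans eq (φ-at {e = f} vf)))
    same-mate : mate π (color e) v ≡ mate π (color f) v
    same-mate = cong (λ c → mate π c v) same-color
    same-edge : Incident G v e → Incident G v f → e ≡ f
    same-edge (inj₁ refl) (inj₁ q) = Graph.edge-≡ G q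
      (trans (sym (mate-lo e)) (trans same-mate (trans (cong (mate π (color f)) q) (mate-lo f))))
    same-edge (inj₂ refl) (inj₂ q) = Graph.edge-≡ G
      (trans (sym (mate-hi e)) (trans same-mate (trans (cong (mate π (color f)) q) (mate-hi f)))) q
    same-edge (inj₁ refl) (inj₂ q) = contradiction
      (subst₂ Fin._<_ (sym hi≡) (sym q) (Edge.lo<hi f))
      (Fin.<-asym (Edge.lo<hi e))
      where
      hi≡ : hi e ≡ lo f
      hi≡ = trans (sym (mate-lo e)) (trans same-mate (trans (cong (mate π (color f)) q) (mate-hi f)))
    same-edge (inj₂ refl) (inj₁ q) = contradiction
      (subst₂ Fin._<_ (sym q) (sym lo≡) (Edge.lo<hi f))
      (Fin.<-asym (Edge.lo<hi e))
      where
      lo≡ : lo e ≡ hi f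
      lo≡ = trans (sym (mate-hi e)) (trans same-mate (trans (cong (mate π (color f)) q) (mate-lo f)))

  -- A new color from block `i` determines both the matching and the label, so it can recur at `w`
  -- only on an edge of the same matching with the same label.
  transfer : ∀ {u w} → ColorSet G φ u ⊆ ColorSet G φ w → ∀ i → used i u ≢ u →
             used i w ≢ w × label i u ≡ label i w
  transfer {u} {w} u⊆w i moved with edge-at moved
  ... | e , ue , refl-color with u⊆w (e , ue , refl)
  ...   | f , wf , eq = subst (λ c → mate π c w ≢ w) f-color (incident-moved {e = f} wf) ,
    paint-label {i} (trans (cong (λ c → paint c u) (sym refl-color)) (trans paints (cong (λ c → paint c w) f-color)))
    where
    paints : paint (color e) u ≡ paint (color f) w
    paints = trans (sym (φ-at {e = e} ue)) (trans (sym eq) (φ-at {e = f} wf))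
    f-color : color f ≡ i ↑ˡ q
    f-color = trans (sym (paint-color paints)) refl-color

  equal-keys : ∀ {u w} → ColorSet G φ u ≐ ColorSet G φ w → ∀ i → key (used i) (label i) u ≡ key (used i) (label i) w
  equal-keys {u} {w} (u⊆w , w⊆u) i = by-cases (used i u ≟ u) (used i w ≟ w)
    where
    by-cases : Dec (used i u ≡ u) → Dec (used i w ≡ w) → key (used i) (label i) u ≡ key (used i) (label i) w
    by-cases (no moved) _ = trans (key-covered (used i) (label i) moved)
      (trans (cong just (proj₂ (transfer u⊆w i moved)))
        (sym (key-covered (used i) (label i) (proj₁ (transfer u⊆w i moved)))))
    by-cases (yes fixed) (no moved) = contradiction fixed (proj₁ (transfer w⊆u i moved))
    by-cases (yes fixed) (yes fixed′) = trans (key-uncovered (used i) (label i) fixed)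
      (sym (key-uncovered (used i) (label i) fixed′))

  avd : AVDEdgeColorable G (T * k + q)
  avd = φ , proper , λ adj same → proj₂ (label-separates adj) (equal-keys same (proj₁ (label-separates adj)))

-- Decidability of colorability and existence of the chromatic index

module _ (G : Graph) where

  incident? : ∀ v e → Dec (Incident G v e)
  incident? v e = (v ≟ lo e) ⊎-dec (v ≟ hi e)

  edge-≟ : (e f : Edge G) → Dec (e ≡ f)
  edge-≟ e f = map′ (λ (p , q) → Graph.edge-≡ G p q) (λ { refl → refl , refl }) ((lo e ≟ lo f) ×-dec (hi e ≟ hi f))

  any-edge? : ∀ {P : Edge G → Set} → Decidable P → Dec (∃[ e ] P e)
  any-edge? {P} P? = map′
    (λ (u , v , p , a , pe) → edge u v p a , pe)
    (λ (edge u v p a , pe) → u , v , p , a , pe)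
    (any? λ u → any? λ v → between u v (u Fin.<? v) (v ∈? neighbourhood G u))
    where
    between : ∀ u v → Dec (u Fin.< v) → Dec (Adjacent G u v) →
              Dec (Σ[ p ∈ u Fin.< v ] Σ[ a ∈ Adjacent G u v ] P (edge u v p a))
    between u v (no ¬p) _       = no λ (p , _) → ¬p p
    between u v (yes p) (no ¬a) = no λ (_ , a , _) → ¬a a
    between u v (yes p) (yes a) = map′ (λ pe → p , a , pe)
      (λ (_ , _ , pe) → subst P (Graph.edge-≡ G refl refl) pe) (P? (edge u v p a))

  all-edges? : ∀ {P : Edge G → Set} → Decidable P → Dec (∀ e → P e)
  all-edges? P? = map′ (λ none e → decidable-stable (P? e) λ ¬pe → none (e , ¬pe))
    (λ all (e , ¬pe) → ¬pe (all e)) (¬? (any-edge? (λ e → ¬? (P? e))))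

  module _ {m : ℕ} where

    color-set? : ∀ (φ : Edge G → Fin m) v → Decidable (ColorSet G φ v)
    color-set? φ v c = any-edge? λ e → incident? v e ×-dec (φ e ≟ c)

    color-set-⊆? : ∀ (φ : Edge G → Fin m) u v → Dec (ColorSet G φ u ⊆ ColorSet G φ v)
    color-set-⊆? φ u v = map′ (λ f {c} → f c) (λ f c → f {c})
      (all? λ c → color-set? φ u c →-dec color-set? φ v c)

    avd? : ∀ (φ : Edge G → Fin m) → Dec (IsAVDEdgeColoring G φ)
    avd? φ = map′ (λ f {e} {g} {v} → f e g v) (λ f e g v → f {e} {g} {v})
        (all-edges? λ e → all-edges? λ f → all? λ v →
          ¬? (edge-≟ e f) →-dec (incident? v e →-dec (incident? v f →-dec ¬? (φ e ≟ φ f))))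
      ×-dec map′ (λ f {u} {v} → f u v) (λ f u v → f {u} {v})
        (all? λ u → all? λ v → (v ∈? neighbourhood G u) →-dec
          ¬? (color-set-⊆? φ u v ×-dec color-set-⊆? φ v u))

    -- For use with `encode`, which recovers a coloring only pointwise.
    avd-cong : ∀ {φ ψ : Edge G → Fin m} → (∀ e → φ e ≡ ψ e) → IsAVDEdgeColoring G φ → IsAVDEdgeColoring G ψ
    avd-cong {φ} {ψ} φ≗ψ (proper , distinct) =
      (λ e≢f ve vf eq → proper e≢f ve vf (trans (φ≗ψ _) (trans eq (sym (φ≗ψ _))))) ,
      λ adj (u⊆v , v⊆u) → distinct adj ((λ c∈ → to φ≗ψ⁻ (u⊆v (to φ≗ψ c∈))) , (λ c∈ → to φ≗ψ⁻ (v⊆u (to φ≗ψ c∈))))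
      where
      φ≗ψ⁻ : ∀ e → ψ e ≡ φ e
      φ≗ψ⁻ e = sym (φ≗ψ e)
      to : ∀ {χ ξ : Edge G → Fin m} → (∀ e → χ e ≡ ξ e) → ∀ {v c} → ColorSet G χ v c → ColorSet G ξ v c
      to χ≗ξ (e , ve , eq) = e , ve , trans (sym (χ≗ξ e)) eq

    -- A coloring is read off a table indexed by all ordered pairs of vertices, itself coded as a
    -- number; so colorability becomes a search through finitely many codes.
    decode : Fin (m ^ (Graph.order G * Graph.order G)) → Edge G → Fin m
    decode code e = finToFun code (combine (lo e) (hi e))

    encode : Edge G → (φ : Edge G → Fin m) → ∃[ code ] (∀ e → φ e ≡ decode code e)
    encode e₀ φ = funToFin table , λ e → sym (trans (finToFun-funToFin table _)
      (trans (cong (λ (u , v) → entry u v) (remQuot-combine (lo e) (hi e))) (entry-edge e)))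
      where
      pick : ∀ {u v} → Dec (u Fin.< v) → Dec (Adjacent G u v) → Fin m
      pick (yes p) (yes a) = φ (edge _ _ p a)
      -- Pairs that are not edges still need an entry; `φ e₀` is a color at hand, whereas `Fin m`
      -- might be empty without an edge.
      pick _       _       = φ e₀
      entry : Vertex G → Vertex G → Fin m
      entry u v = pick (u Fin.<? v) (v ∈? neighbourhood G u)
      table : Fin (Graph.order G * Graph.order G) → Fin m
      table uv = let (u , v) = remQuot (Graph.order G) uv in entry u v
      pick-edge : ∀ e p? a? → pick {lo e} {hi e} p? a? ≡ φ e
      pick-edge e (yes p) (yes a) = cong φ (Graph.edge-≡ G refl refl)
      pick-edge e (yes p) (no ¬a) = contradiction (Edge.adjacent e) ¬a
      pick-edge e (no ¬p) _       = contradiction (Edge.lo<hi e) ¬p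
      entry-edge : ∀ e → entry (lo e) (hi e) ≡ φ e
      entry-edge e = pick-edge e (lo e Fin.<? hi e) (hi e ∈? neighbourhood G (lo e))

  colorable? : Decidable (AVDEdgeColorable G)
  colorable? m with any-edge? (λ _ → yes tt)
  ... | yes (e₀ , _) = map′ (λ (code , good) → decode code , good)
    (λ (φ , good) → let code , eq = encode e₀ φ in code , avd-cong eq good)
    (any? (λ code → avd? (decode code)))
  -- Without edges the empty coloring works for every `m`, zero included.
  ... | no none = yes ((λ e → contradiction (e , tt) none) , (λ {e} → contradiction (e , tt) none) ,
    λ {u} {v} adj → contradiction (edge-of adj , tt) none)
    where
    edge-of : ∀ {u v} → Adjacent G u v → Edge G
    edge-of {u} {v} adj with Fin.<-cmp u v
    ... | tri< u<v _ _  = edge u v u<v adj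
    ... | tri≈ _ refl _ = contradiction adj (Graph.no-loop G)
    ... | tri> _ _ v<u  = edge v u v<u (Graph.symmetric G adj)

  chromatic-index : ∀ {m} → AVDEdgeColorable G m → ∃[ χ ] IsAVDChromaticIndex G χ × χ ≤ m
  chromatic-index good with least {P = AVDEdgeColorable G} colorable? good
  ... | χ , χ-good , χ≤m , minimal = χ , (χ-good , λ _ → minimal) , χ≤m

-- Comparison with (5r + 37)/3 in the rationals

open import Data.Integer.Base as ℤ using (+_; +≤+)

/1≤/3 : ∀ {m n} → 3 * m ≤ n → (+ m / 1) ≤ℚ (+ n / 3)
/1≤/3 {m} {n} 3m≤n = toℚᵘ-cancel-≤ (ℚᵘ.≤-respˡ-≃ (ℚᵘ.≃-sym (toℚᵘ-fromℚᵘ (mkℚᵘ (+ m) 0)))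
  (ℚᵘ.≤-respʳ-≃ (ℚᵘ.≃-sym (toℚᵘ-fromℚᵘ (mkℚᵘ (+ n) 2)))
    (*≤* (subst₂ ℤ._≤_ (ℤ.pos-* m 3) (ℤ.pos-* n 1)
      (+≤+ (subst₂ _≤_ (ℕ.*-comm 3 m) (sym (ℕ.*-identityʳ n)) 3m≤n))))))

theorem3p3 : ∀ (G : Graph) (r : ℕ) → r ℕ.≥ 2 → Regular G r →
    ∃[ χ ] IsAVDChromaticIndex G χ × (+ χ / 1) ≤ℚ (+ (5 ℕ.* r ℕ.+ 37) / 3)
theorem3p3 G r r≥2 regular with parameters-exist r r≥2
... | params with chromatic-index G (Recolor.avd regular params)
...   | χ , index , χ≤ = χ , index , /1≤/3 {χ} (ℕ.≤-trans (ℕ.*-monoʳ-≤ 3 χ≤) (Parameters.cheap params))
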